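{- Any recursively enumerable set (of non-negative integers) can be recognized by an $\mathrm{ARAM}[+,/,\leftarrow,\mathit{Bool}]$ in $O(1)$ time.
   Context: RAM model. A random access machine $\mathrm{RAM}[op]$ has infinitely many registers $R[0],R[1],\dots$ holding non-negative integers. A program is a finite list of labelled commands (execution starts at label 1 and proceeds sequentially except at comparisons and jumps). Commands are: assignments (apply a $k$-ary operation from $op$ to $k$ operands and store the result in a target register), comparisons (test two operands for equality and proceed to one of two labels according to the result), unconditional jumps, and halts. Each operand is either an explicit constant from $\{0,1\}$ or the contents of an explicitly named register; indirect addressing is not available. Each command takes one unit of time. Inputs are placed in the first registers, all other registers are initialized to $0$, and the output is the content of the first register on termination. Operations: $a/b$ is exact division, equal to integer division but defined only when $b$ divides $a$ exactly; $a\leftarrow b=a\cdot 2^b$; $\mathit{Bool}$ is the set of all bitwise Boolean functions, where negation is modified so that $\neg a$ negates the bits of $a$ only up to and including its most significant $1$ bit. ARAM (RAM assisted by an arbitrary large number). A set $S$ of non-negative integers is computable (recognized) by an $\mathrm{ARAM}[op]$ in $f(n)$ time if there exists a Boolean function $g(inp,x)$, computable in $f(n)$ time on a $\mathrm{RAM}[op]$ (where $n$ is the bit-length of $inp$), such that $inp\in S$ implies $g(inp,x)\neq 0$ for all but finitely many non-negative integers $x$, and $inp\notin S$ implies $g(inp,x)=0$ for all but finitely many $x$. -}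

module Defs where

open import Data.Bool.Base using (Bool; true; false; if_then_else_)
open import Data.List.Base using (List; []; _∷_)
open import Data.List.Membership.Propositional using (_∉_)
open import Data.Maybe.Base using (Maybe; just; nothing)
open import Data.Nat.Base
  using (ℕ; zero; suc; _+_; _*_; _^_; _⊔_; _≤_; _≡ᵇ_)
open import Data.Nat.DivMod using (_/_; _%_)
open import Data.Nat.Logarithm using (⌊log₂_⌋)
open import Data.Product.Base using (Σ-syntax; ∃-syntax; _×_)
open import Data.Vec.Base as Vec using (Vec; []; _∷_)
open import Function.Bundles using (_⇔_)
open import Level using (0ℓ)
open import Relation.Binary.PropositionalEquality.Core using (_≡_; _≢_)
open import Relation.Nullary.Negation.Core using (¬_)
open import Relation.Unary using (Pred)

------------------------------------------------------------------------
-- Binary representation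

bitLength : ℕ → ℕ
bitLength zero      = 0
bitLength n@(suc _) = suc ⌊log₂ n ⌋

testBit : ℕ → ℕ → Bool
testBit a zero    = a % 2 ≡ᵇ 1
testBit a (suc i) = testBit (a / 2) i

fromBool : Bool → ℕ
fromBool b = if b then 1 else 0

-- fromBits n b = Σ_{i<n} b(i)·2^i
fromBits : ℕ → (ℕ → Bool) → ℕ
fromBits zero    b = 0
fromBits (suc n) b = fromBool (b 0) + 2 * fromBits n (λ i → b (suc i))

-- f is applied at every bit position up to and including the most
-- significant 1 of the largest operand.  If f (0,…,0) is false this is the
-- plain bitwise application of f, the higher bits being all false; for
-- unary negation it is the modified ¬.
bitwise : ∀ {k} → (Vec Bool k → Bool) → Vec ℕ k → ℕ
bitwise f as =
  fromBits (bitLength (Vec.foldr′ _⊔_ 0 as))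
           (λ i → f (Vec.map (λ a → testBit a i) as))

-- Undefined when b does not divide a, and for b = 0.
exactDiv : ℕ → ℕ → Maybe ℕ
exactDiv a zero      = nothing
exactDiv a b@(suc _) = if a % b ≡ᵇ 0 then just (a / b) else nothing

------------------------------------------------------------------------
-- Operation sets

record OpSet : Set₁ where
  field
    Op    : Set
    arity : Op → ℕ
    apply : (o : Op) → Vec ℕ (arity o) → Maybe ℕ

module Plus where
  data Op : Set where
    add : Op

  arity : Op → ℕ
  arity add = 2

  apply : (o : Op) → Vec ℕ (arity o) → Maybe ℕ
  apply add (a ∷ b ∷ []) = just (a + b)

[+] : OpSet
[+] = record { Plus }

module PlusDivShiftBool where
  data Op : Set where
    add  : Op
    div  : Op
    shl  : Op
    bool : (k : ℕ) → (Vec Bool k → Bool) → Op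

  arity : Op → ℕ
  arity add        = 2
  arity div        = 2
  arity shl        = 2
  arity (bool k _) = k

  apply : (o : Op) → Vec ℕ (arity o) → Maybe ℕ
  apply add        (a ∷ b ∷ []) = just (a + b)
  apply div        (a ∷ b ∷ []) = exactDiv a b
  apply shl        (a ∷ b ∷ []) = just (a * 2 ^ b)
  apply (bool _ f) as           = just (bitwise f as)

[+,/,←,Bool] : OpSet
[+,/,←,Bool] = record { PlusDivShiftBool }

------------------------------------------------------------------------
-- Random access machines

Registers : Set
Registers = ℕ → ℕ

_[_≔_] : Registers → ℕ → ℕ → Registers
(R [ i ≔ v ]) j = if j ≡ᵇ i then v else R j

data Operand : Set where
  𝟎 𝟏 : Operand
  reg : ℕ → Operand

value : Registers → Operand → ℕ
value R 𝟎       = 0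
value R 𝟏       = 1
value R (reg i) = R i

Label : Set
Label = ℕ

module _ (ops : OpSet) where
  open OpSet ops

  data Command : Set where
    assign  : (target : ℕ) (o : Op) → Vec Operand (arity o) → Command
    compare : (a b : Operand) (if-equal if-different : Label) → Command
    jump    : Label → Command
    halt    : Command

  Program : Set
  Program = List Command

module _ {ops : OpSet} where
  open OpSet ops

  -- The commands are labelled 1, 2, … in order.
  fetch : Program ops → Label → Maybe (Command ops)
  fetch []      _             = nothing
  fetch (c ∷ P) zero          = nothing
  fetch (c ∷ P) (suc zero)    = just c
  fetch (c ∷ P) (suc (suc l)) = fetch P (suc l)

  -- P ⊢ l , R ⇓[ t ] v : started at label l with register contents R, the
  -- program P executes exactly t commands, the last one being a halt, and
  -- outputs v.  Nothing is derivable for a run that evaluates an undefined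
  -- operation or reaches a label carrying no command.
  data _⊢_,_⇓[_]_ (P : Program ops) : Label → Registers → ℕ → ℕ → Set where
    halt : ∀ {l R} →
           fetch P l ≡ just halt →
           P ⊢ l , R ⇓[ 1 ] R 0
    jump : ∀ {l R t v l′} →
           fetch P l ≡ just (jump l′) →
           P ⊢ l′ , R ⇓[ t ] v →
           P ⊢ l , R ⇓[ suc t ] v
    compare-≡ : ∀ {l R t v a b l₁ l₂} →
           fetch P l ≡ just (compare a b l₁ l₂) →
           value R a ≡ value R b →
           P ⊢ l₁ , R ⇓[ t ] v →
           P ⊢ l , R ⇓[ suc t ] v
    compare-≢ : ∀ {l R t v a b l₁ l₂} →
           fetch P l ≡ just (compare a b l₁ l₂) →
           value R a ≢ value R b →
           P ⊢ l₂ , R ⇓[ t ] v →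
           P ⊢ l , R ⇓[ suc t ] v
    assign : ∀ {l R t v i o w} {as : Vec Operand (arity o)} →
           fetch P l ≡ just (assign i o as) →
           apply o (Vec.map (value R) as) ≡ just w →
           P ⊢ suc l , R [ i ≔ w ] ⇓[ t ] v →
           P ⊢ l , R ⇓[ suc t ] v

  initial : List ℕ → Registers
  initial []       _       = 0
  initial (a ∷ as) zero    = a
  initial (a ∷ as) (suc i) = initial as i

  _on_⇓[_]_ : Program ops → List ℕ → ℕ → ℕ → Set
  P on inputs ⇓[ t ] v = P ⊢ 1 , initial inputs ⇓[ t ] v

  HaltsOn : Program ops → List ℕ → Set
  HaltsOn P inputs = ∃[ t ] ∃[ v ] P on inputs ⇓[ t ] v

------------------------------------------------------------------------
-- Recursively enumerable sets

-- The halting sets of RAM[+] programs.  Cutland's unlimited register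
-- machines are included command by command: r ← 0 + 0, r ← r + 1,
-- r ← s + 0 and the equality jump are the zero, successor, transfer and jump
-- instructions.
RecursivelyEnumerable : ∀ {ℓ} → Pred ℕ ℓ → Set ℓ
RecursivelyEnumerable S =
  Σ[ P ∈ Program [+] ] (∀ inp → S inp ⇔ HaltsOn P (inp ∷ []))

------------------------------------------------------------------------
-- RAMs assisted by an arbitrary large number

ComputableInTime : OpSet → (ℕ → ℕ) → (ℕ → ℕ → Bool) → Set
ComputableInTime ops f g =
  Σ[ P ∈ Program ops ] (∀ inp x →
    ∃[ t ] t ≤ f (bitLength inp) ×
           P on (inp ∷ x ∷ []) ⇓[ t ] fromBool (g inp x))

AllButFinitelyMany : Pred ℕ 0ℓ → Set
AllButFinitelyMany Q = Σ[ xs ∈ List ℕ ] (∀ x → x ∉ xs → Q x)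

ARAM_Recognizes_InTime_ : ∀ {ℓ} → OpSet → Pred ℕ ℓ → (ℕ → ℕ) → Set ℓ
ARAM ops Recognizes S InTime f =
  Σ[ g ∈ (ℕ → ℕ → Bool) ] ComputableInTime ops f g ×
    (∀ inp → (S inp → AllButFinitelyMany (λ x → fromBool (g inp x) ≢ 0)) ×
             ((¬ S inp) → AllButFinitelyMany (λ x → fromBool (g inp x) ≡ 0)))

_∈O[_] : (ℕ → ℕ) → (ℕ → ℕ) → Set
f ∈O[ h ] = ∃[ c ] ∃[ n₀ ] (∀ n → n₀ ≤ n → f n ≤ c * h n)

{-# OPTIONS --safe #-}

-- A computation that halts is a finite tableau of bits, its rows being the successive register
-- contents.  Scanning the rows bit by bit, lowest bit first, each cell is a function of the cell
-- read before it and of the cell above it.  From x we choose the width and the number of rows of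
-- the tableau and write all its candidate fillings side by side into one huge number,
-- T = Σ i·yⁱ (i < N), obtained in closed form by exact division by y − 1.  A single bitwise
-- operation applied to a few shifted copies of T then marks the faulty cells of all candidates at
-- once, and one addition, carrying out of each nonzero block, tells whether some candidate is
-- fault-free and ends in a halt.  The machine accepts for every large x if the program halts, and
-- for no x otherwise.
module Submission where

open import Defs
open import Data.Bool.Base using (Bool; true; false; not; _∧_; _∨_; _xor_; if_then_else_; T)
import Data.Bool.Properties as Bool
open import Data.Fin.Base using (Fin; zero; suc; toℕ; _↑ˡ_; _↑ʳ_; splitAt; remQuot; combine)
open import Data.Fin.Properties using (toℕ<n; splitAt-↑ˡ; splitAt-↑ʳ; remQuot-combine)
open import Data.List.Base using ([]; _∷_; _++_; length; upTo)
open import Data.List.Membership.Propositional.Properties using (∈-upTo⁺)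
open import Data.List.Properties using (++-assoc; length-++)
open import Data.Maybe.Base using (Maybe; just; nothing)
open import Data.Nat.Base hiding (compare)
open import Data.Nat.Divisibility using (divides)
open import Data.Nat.DivMod
  using (_/_; _%_; m≡m%n+[m/n]*n; m%n<n; [m+kn]%n≡m%n; m*n%n≡0; m*n/n≡m; +-distrib-/-∣ʳ; m<n*o⇒m/o<n)
open import Data.Nat.Logarithm
open import Data.Nat.Properties
open import Data.Nat.Tactic.RingSolver using (solve-∀)
open import Data.Product.Base using (_×_; _,_; proj₁; proj₂; ∃-syntax; Σ-syntax)
open import Data.Sum.Base using (_⊎_; inj₁; inj₂)
open import Data.Vec.Base as Vec using (Vec; []; _∷_)
import Data.Vec.Properties as Vec
open import Function.Base using (_∘_)
open import Function.Bundles using (Equivalence)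
open import Relation.Binary.PropositionalEquality
open import Relation.Nullary using (Dec; yes; no; ¬_; does; contradiction)
open import Relation.Nullary.Decidable using (dec-true)
open import Relation.Unary using (Pred)

-- The operations include no multiplication, no subtraction and no rounding division, and this
-- dictates the sizes. With width `c` = 1 + inp + x and 2 ^ x rows, every product to be computed has
-- as a factor a power of two or a number fixed by the simulated program, so it is a shift or a
-- repeated addition. A cell has `K` bits, and a candidate is nothing but a number below 2 ^ `M`,
-- where `M` = (K + 1) · rows · c: all fillings occur because all numbers of that length do. The
-- number of operations depends on `K` alone, hence only on the simulated program. The width may be
-- too small for the registers of the run. Overflow therefore sends the simulated machine to a label
-- without a command, so a fault-free accepting candidate proves halting for every x, not only for
-- large ones. Conversely, register contents at most double in a step, so up to a halt after τ₀
-- steps they are at most 2 ^ τ₀ · (inp + 1), which fits once x ≥ τ₀. A halted configuration repeats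
-- itself, so only the last row has to be examined.

2^n>0 : ∀ n → 0 < 2 ^ n
2^n>0 = m^n>0 2

2^-mono-≤ : ∀ {m n} → m ≤ n → 2 ^ m ≤ 2 ^ n
2^-mono-≤ = ^-monoʳ-≤ 2

2^-mono-< : ∀ {m n} → m < n → 2 ^ m < 2 ^ n
2^-mono-< = ^-monoʳ-< 2 (s≤s (s≤s z≤n))

n<2^n : ∀ n → n < 2 ^ n
n<2^n zero    = s≤s z≤n
n<2^n (suc n) = begin-strict
  suc n           ≤⟨ n<2^n n ⟩
  2 ^ n           <⟨ m<m+n (2 ^ n) (2^n>0 n) ⟩
  2 ^ n + 2 ^ n   ≡⟨ cong (2 ^ n +_) (+-identityʳ (2 ^ n)) ⟨
  2 ^ suc n       ∎
  where open ≤-Reasoning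

-- Bits

testBit-cons-0 : ∀ b a → testBit (fromBool b + 2 * a) 0 ≡ b
testBit-cons-0 b a
  rewrite *-comm 2 a | [m+kn]%n≡m%n (fromBool b) a 2 ⦃ _ ⦄ with b
... | true  = refl
... | false = refl

cons-/2 : ∀ b a → (fromBool b + 2 * a) / 2 ≡ a
cons-/2 b a = begin
  (fromBool b + 2 * a) / 2   ≡⟨ +-distrib-/-∣ʳ (fromBool b) (divides a (*-comm 2 a)) ⟩
  fromBool b / 2 + 2 * a / 2 ≡⟨ cong₂ _+_ (bit/2 b) (cong (_/ 2) (*-comm 2 a)) ⟩
  a * 2 / 2                  ≡⟨ m*n/n≡m a 2 ⟩
  a                          ∎
  where
  open ≡-Reasoning
  bit/2 : ∀ b → fromBool b / 2 ≡ 0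
  bit/2 true  = refl
  bit/2 false = refl

testBit-cons-suc : ∀ b a i → testBit (fromBool b + 2 * a) (suc i) ≡ testBit a i
testBit-cons-suc b a i = cong (λ a → testBit a i) (cons-/2 b a)

cons-testBit : ∀ a → fromBool (testBit a 0) + 2 * (a / 2) ≡ a
cons-testBit a = begin
  fromBool (testBit a 0) + 2 * (a / 2) ≡⟨ cong₂ _+_ (low (a % 2) (m%n<n a 2)) (*-comm 2 (a / 2)) ⟩
  a % 2 + a / 2 * 2                    ≡⟨ m≡m%n+[m/n]*n a 2 ⟨
  a                                    ∎
  where
  open ≡-Reasoning
  low : ∀ r → r < 2 → fromBool (r ≡ᵇ 1) ≡ r
  low 0 _ = refl
  low 1 _ = refl
  low (suc (suc _)) (s≤s (s≤s ()))

testBit-zero : ∀ i → testBit 0 i ≡ false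
testBit-zero zero    = refl
testBit-zero (suc i) = testBit-zero i

testBit-≥ : ∀ n {a i} → a < 2 ^ n → n ≤ i → testBit a i ≡ false
testBit-≥ zero    {a} {i} a<1 _ rewrite n<1⇒n≡0 a<1 = testBit-zero i
testBit-≥ (suc n) {a} {suc i} a<2^n (s≤s n≤i) =
  testBit-≥ n (m<n*o⇒m/o<n (subst (a <_) (*-comm 2 (2 ^ n)) a<2^n)) n≤i

fromBits-cong : ∀ n {f g : ℕ → Bool} → (∀ i → i < n → f i ≡ g i) → fromBits n f ≡ fromBits n g
fromBits-cong zero    f≗g = refl
fromBits-cong (suc n) f≗g =
  cong₂ (λ b a → fromBool b + 2 * a) (f≗g 0 z<s) (fromBits-cong n λ i i<n → f≗g (suc i) (s<s i<n))

fromBits-testBit : ∀ n {a} → a < 2 ^ n → fromBits n (testBit a) ≡ a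
fromBits-testBit zero    a<1 = sym (n<1⇒n≡0 a<1)
fromBits-testBit (suc n) {a} a<2^n = trans
  (cong (λ a′ → fromBool (testBit a 0) + 2 * a′)
    (fromBits-testBit n (m<n*o⇒m/o<n (subst (a <_) (*-comm 2 (2 ^ n)) a<2^n))))
  (cons-testBit a)

-- Both numbers lie below 2 ^ (a + b), so that many bits determine them.
testBit-injective : ∀ {a b} → (∀ i → testBit a i ≡ testBit b i) → a ≡ b
testBit-injective {a} {b} a≗b = begin
  a                            ≡⟨ fromBits-testBit (a + b) (≤-<-trans (m≤m+n a b) (n<2^n (a + b))) ⟨
  fromBits (a + b) (testBit a) ≡⟨ fromBits-cong (a + b) (λ i _ → a≗b i) ⟩
  fromBits (a + b) (testBit b) ≡⟨ fromBits-testBit (a + b) (≤-<-trans (m≤n+m b a) (n<2^n (a + b))) ⟩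
  b                            ∎
  where open ≡-Reasoning

testBit-fromBits-++-low : ∀ n f b {i} → i < n → testBit (fromBits n f + 2 ^ n * b) i ≡ f i
testBit-fromBits-++-high : ∀ n f b i → testBit (fromBits n f + 2 ^ n * b) (n + i) ≡ testBit b i

private
  cons-++ : ∀ n f b → fromBits (suc n) f + 2 ^ suc n * b ≡
                      fromBool (f 0) + 2 * (fromBits n (λ i → f (suc i)) + 2 ^ n * b)
  cons-++ n f b = lemma (fromBool (f 0)) (fromBits n (λ i → f (suc i))) (2 ^ n) b
    where
    lemma : ∀ x y p b → x + 2 * y + 2 * p * b ≡ x + 2 * (y + p * b)
    lemma = solve-∀

testBit-fromBits-++-low (suc n) f b {zero} _ =
  trans (cong (λ a → testBit a 0) (cons-++ n f b))
    (testBit-cons-0 (f 0) (fromBits n (λ i → f (suc i)) + 2 ^ n * b))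
testBit-fromBits-++-low (suc n) f b {suc i} (s≤s i<n) =
  trans (cong (λ a → testBit a (suc i)) (cons-++ n f b))
    (trans (testBit-cons-suc (f 0) _ i) (testBit-fromBits-++-low n (λ i → f (suc i)) b i<n))

testBit-fromBits-++-high zero    f b i = cong (λ a → testBit a i) (+-identityʳ b)
testBit-fromBits-++-high (suc n) f b i =
  trans (cong (λ a → testBit a (suc n + i)) (cons-++ n f b))
    (trans (testBit-cons-suc (f 0) _ (n + i)) (testBit-fromBits-++-high n (λ i → f (suc i)) b i))

fromBits-< : ∀ n f → fromBits n f < 2 ^ n
fromBits-< zero    f = s≤s z≤n
fromBits-< (suc n) f = begin-strict
  fromBool (f 0) + 2 * a ≤⟨ +-monoˡ-≤ (2 * a) (bit≤1 (f 0)) ⟩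
  1 + 2 * a              <⟨ n<1+n _ ⟩
  2 + 2 * a              ≡⟨ *-suc 2 a ⟨
  2 * suc a              ≤⟨ *-monoʳ-≤ 2 (fromBits-< n (λ i → f (suc i))) ⟩
  2 * 2 ^ n              ∎
  where
  open ≤-Reasoning
  a : ℕ
  a = fromBits n (λ i → f (suc i))
  bit≤1 : ∀ b → fromBool b ≤ 1
  bit≤1 true  = s≤s z≤n
  bit≤1 false = z≤n

testBit-fromBits : ∀ n f {i} → i < n → testBit (fromBits n f) i ≡ f i
testBit-fromBits n f {i} i<n = trans
  (cong (λ a → testBit a i) (sym (trans (cong (fromBits n f +_) (*-zeroʳ (2 ^ n))) (+-identityʳ _))))
  (testBit-fromBits-++-low n f 0 i<n)

testBit-++-low : ∀ n {a} b {i} → a < 2 ^ n → i < n → testBit (a + 2 ^ n * b) i ≡ testBit a i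
testBit-++-low n {a} b {i} a<2^n i<n =
  subst (λ a′ → testBit (a′ + 2 ^ n * b) i ≡ testBit a i) (fromBits-testBit n a<2^n)
    (testBit-fromBits-++-low n (testBit a) b i<n)

testBit-++-high : ∀ n {a} b i → a < 2 ^ n → testBit (a + 2 ^ n * b) (n + i) ≡ testBit b i
testBit-++-high n {a} b i a<2^n =
  subst (λ a′ → testBit (a′ + 2 ^ n * b) (n + i) ≡ testBit b i) (fromBits-testBit n a<2^n)
    (testBit-fromBits-++-high n (testBit a) b i)

testBit-shl-low : ∀ a s {i} → i < s → testBit (a * 2 ^ s) i ≡ false
testBit-shl-low a s {i} i<s = begin
  testBit (a * 2 ^ s) i     ≡⟨ cong (λ a → testBit a i) (*-comm a (2 ^ s)) ⟩
  testBit (0 + 2 ^ s * a) i ≡⟨ testBit-++-low s a (2^n>0 s) i<s ⟩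
  testBit 0 i               ≡⟨ testBit-zero i ⟩
  false                     ∎
  where open ≡-Reasoning

testBit-shl-high : ∀ a s i → testBit (a * 2 ^ s) (s + i) ≡ testBit a i
testBit-shl-high a s i =
  trans (cong (λ a → testBit a (s + i)) (*-comm a (2 ^ s))) (testBit-++-high s a i (2^n>0 s))

shl-< : ∀ {a} m s {n} → a < 2 ^ m → m + s ≤ n → a * 2 ^ s < 2 ^ n
shl-< {a} m s {n} a<2^m m+s≤n = begin-strict
  a * 2 ^ s     <⟨ *-monoˡ-< (2 ^ s) ⦃ m^n≢0 2 s ⦄ a<2^m ⟩
  2 ^ m * 2 ^ s ≡⟨ ^-distribˡ-+-* 2 m s ⟨
  2 ^ (m + s)   ≤⟨ 2^-mono-≤ m+s≤n ⟩
  2 ^ n         ∎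
  where open ≤-Reasoning

++-< : ∀ m n {a b} → a < 2 ^ m → b < 2 ^ n → a + 2 ^ m * b < 2 ^ (m + n)
++-< m n {a} {b} a<2^m b<2^n = begin-strict
  a + 2 ^ m * b         <⟨ +-monoˡ-< (2 ^ m * b) a<2^m ⟩
  2 ^ m + 2 ^ m * b     ≡⟨ *-suc (2 ^ m) b ⟨
  2 ^ m * suc b         ≤⟨ *-monoʳ-≤ (2 ^ m) b<2^n ⟩
  2 ^ m * 2 ^ n         ≡⟨ ^-distribˡ-+-* 2 m n ⟨
  2 ^ (m + n)           ∎
  where open ≤-Reasoning

testBit-ones : ∀ n {i} → i < n → testBit (2 ^ n ∸ 1) i ≡ true
testBit-ones n {i} i<n = trans (cong (λ a → testBit a i) (sym (ones n))) (testBit-fromBits n _ i<n)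
  where
  lemma : ∀ a → 1 + (1 + 2 * a) ≡ 2 * (1 + a)
  lemma = solve-∀
  ones′ : ∀ n → suc (fromBits n (λ _ → true)) ≡ 2 ^ n
  ones′ zero    = refl
  ones′ (suc n) = trans (lemma (fromBits n (λ _ → true))) (cong (2 *_) (ones′ n))
  ones : ∀ n → fromBits n (λ _ → true) ≡ 2 ^ n ∸ 1
  ones n = cong (_∸ 1) (ones′ n)

2^n∸1<2^n : ∀ n → 2 ^ n ∸ 1 < 2 ^ n
2^n∸1<2^n n = ∸-monoʳ-< {n = 1} {o = 0} (s≤s z≤n) (2^n>0 n)

-- Bit lengths and bitwise operations

<2^bitLength : ∀ a → a < 2 ^ bitLength a
<2^bitLength zero    = s≤s z≤n
<2^bitLength a@(suc _) = ≰⇒> λ 2^n≤a → n≮n _ (subst (_≤ ⌊log₂ a ⌋)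
  (⌊log₂[2^n]⌋≡n (suc ⌊log₂ a ⌋)) (⌊log₂⌋-mono-≤ 2^n≤a))

bitLength-mono-≤ : ∀ {a b} → a ≤ b → bitLength a ≤ bitLength b
bitLength-mono-≤ {zero}          _   = z≤n
bitLength-mono-≤ {suc a} {suc b} a≤b = s≤s (⌊log₂⌋-mono-≤ a≤b)

bitLength-≤ : ∀ n a → a < 2 ^ n → bitLength a ≤ n
bitLength-≤ n       zero        _     = z≤n
bitLength-≤ zero    (suc a)     (s≤s ())
bitLength-≤ (suc n) 1           _     = s≤s z≤n
bitLength-≤ (suc n) a@(suc (suc a′)) a<2^n = s≤s (begin
  -- Since a ≥ 2 the logarithm is positive, so the truncated predecessor in the halving law loses
  -- nothing.
  ⌊log₂ a ⌋           ≡⟨ suc-pred ⌊log₂ a ⌋ ⦃ >-nonZero (⌊log₂⌋-mono-≤ {2} {a} (s≤s (s≤s z≤n))) ⦄ ⟨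
  suc (⌊log₂ a ⌋ ∸ 1) ≡⟨ cong suc (⌊log₂⌊n/2⌋⌋≡⌊log₂n⌋∸1 a) ⟨
  bitLength ⌊ a /2⌋   ≤⟨ bitLength-≤ n ⌊ a /2⌋ half ⟩
  n                   ∎)
  where
  open ≤-Reasoning
  double : ∀ n → ⌊ n /2⌋ + ⌊ n /2⌋ ≤ n
  double n = begin
    ⌊ n /2⌋ + ⌊ n /2⌋ ≤⟨ +-monoʳ-≤ ⌊ n /2⌋ (⌊n/2⌋≤⌈n/2⌉ n) ⟩
    ⌊ n /2⌋ + ⌈ n /2⌉ ≡⟨ ⌊n/2⌋+⌈n/2⌉≡n n ⟩
    n                 ∎
  half : ⌊ a /2⌋ < 2 ^ n
  half = *-cancelˡ-< 2 _ _ (begin-strict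
    2 * ⌊ a /2⌋         ≡⟨ cong (⌊ a /2⌋ +_) (+-identityʳ ⌊ a /2⌋) ⟩
    ⌊ a /2⌋ + ⌊ a /2⌋   ≤⟨ double a ⟩
    a                   <⟨ a<2^n ⟩
    2 * 2 ^ n           ∎)

maximum : ∀ {k} → Vec ℕ k → ℕ
maximum = Vec.foldr′ _⊔_ 0

testBit-maximum : ∀ {k} (as : Vec ℕ k) {i} → bitLength (maximum as) ≤ i →
                  Vec.map (λ a → testBit a i) as ≡ Vec.replicate k false
testBit-maximum []       _ = refl
testBit-maximum (a ∷ as) {i} max≤i = cong₂ _∷_
  (testBit-≥ (bitLength a) (<2^bitLength a) (≤-trans (bitLength-mono-≤ (m≤m⊔n a (maximum as))) max≤i))
  (testBit-maximum as (≤-trans (bitLength-mono-≤ (m≤n⊔m a (maximum as))) max≤i))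

maximum-< : ∀ {k} n (φ : Fin k → ℕ) → (∀ j → φ j < 2 ^ n) → maximum (Vec.tabulate φ) < 2 ^ n
maximum-< {zero}  n φ φ<2^n = 2^n>0 n
maximum-< {suc k} n φ φ<2^n =
  ⊔-lub (φ<2^n zero) (maximum-< n (λ j → φ (suc j)) (λ j → φ<2^n (suc j)))

module _ {k} (f : Vec Bool k → Bool) (f0 : f (Vec.replicate k false) ≡ false) where

  -- `f0` makes the cut-off at the longest operand invisible: above it all operand bits are false,
  -- and so is the value of `f`.
  testBit-bitwise : ∀ (φ : Fin k → ℕ) i →
                    testBit (bitwise f (Vec.tabulate φ)) i ≡ f (Vec.tabulate (λ j → testBit (φ j) i))
  testBit-bitwise φ i = trans bit (cong f (sym (Vec.tabulate-∘ (λ a → testBit a i) φ)))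
    where
    as : Vec ℕ k
    as = Vec.tabulate φ
    n : ℕ
    n = bitLength (maximum as)
    g : ℕ → Bool
    g i = f (Vec.map (λ a → testBit a i) as)
    bit : testBit (fromBits n g) i ≡ g i
    bit with i <? n
    ... | yes i<n = testBit-fromBits n g i<n
    ... | no  i≮n = trans (testBit-≥ n (fromBits-< n g) (≮⇒≥ i≮n))
                          (sym (trans (cong f (testBit-maximum as (≮⇒≥ i≮n))) f0))

  bitwise-< : ∀ n (φ : Fin k → ℕ) → (∀ j → φ j < 2 ^ n) → bitwise f (Vec.tabulate φ) < 2 ^ n
  bitwise-< n φ φ<2^n = <-≤-trans (fromBits-< (bitLength (maximum (Vec.tabulate φ))) _)
    (2^-mono-≤ (bitLength-≤ n (maximum (Vec.tabulate φ)) (maximum-< n φ φ<2^n)))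

  -- Bitwise operations have no carries, so the low and the high block do not interact. This is what
  -- lets one operation treat all candidates in parallel.
  bitwise-++ : ∀ n (φ ψ : Fin k → ℕ) → (∀ j → φ j < 2 ^ n) →
               bitwise f (Vec.tabulate (λ j → φ j + 2 ^ n * ψ j)) ≡
               bitwise f (Vec.tabulate φ) + 2 ^ n * bitwise f (Vec.tabulate ψ)
  bitwise-++ n φ ψ φ<2^n = testBit-injective bit
    where
    open ≡-Reasoning
    χ : Fin k → ℕ
    χ j = φ j + 2 ^ n * ψ j
    φ̂ ψ̂ : ℕ
    φ̂ = bitwise f (Vec.tabulate φ)
    ψ̂ = bitwise f (Vec.tabulate ψ)
    bit : ∀ i → testBit (bitwise f (Vec.tabulate χ)) i ≡ testBit (φ̂ + 2 ^ n * ψ̂) i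
    bit i with i <? n
    ... | yes i<n = begin
      testBit (bitwise f (Vec.tabulate χ)) i     ≡⟨ testBit-bitwise χ i ⟩
      f (Vec.tabulate (λ j → testBit (χ j) i))   ≡⟨ cong f (Vec.tabulate-cong λ j → testBit-++-low n (ψ j) (φ<2^n j) i<n) ⟩
      f (Vec.tabulate (λ j → testBit (φ j) i))   ≡⟨ testBit-bitwise φ i ⟨
      testBit φ̂ i                                ≡⟨ testBit-++-low n ψ̂ (bitwise-< n φ φ<2^n) i<n ⟨
      testBit (φ̂ + 2 ^ n * ψ̂) i                  ∎
    ... | no  i≮n with r , refl ← m≤n⇒∃[o]m+o≡n (≮⇒≥ i≮n) = begin
      testBit (bitwise f (Vec.tabulate χ)) (n + r)     ≡⟨ testBit-bitwise χ (n + r) ⟩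
      f (Vec.tabulate (λ j → testBit (χ j) (n + r)))   ≡⟨ cong f (Vec.tabulate-cong λ j → testBit-++-high n (ψ j) r (φ<2^n j)) ⟩
      f (Vec.tabulate (λ j → testBit (ψ j) r))         ≡⟨ testBit-bitwise ψ r ⟨
      testBit ψ̂ r                                      ≡⟨ testBit-++-high n ψ̂ r (bitwise-< n φ φ<2^n) ⟨
      testBit (φ̂ + 2 ^ n * ψ̂) (n + r)                  ∎

-- Negates the second operand; the first serves only to fix how many bits are negated, namely those
-- of the longer operand. With equal operands it is the modified negation.
complement : ℕ → ℕ → ℕ
complement a b = bitwise (λ v → not (Vec.lookup v (suc zero))) (a ∷ b ∷ [])

fromBits-not : ∀ n f → fromBits n (λ i → not (f i)) + fromBits n f ≡ 2 ^ n ∸ 1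
fromBits-not n f = cong (_∸ 1) (go n f)
  where
  open ≡-Reasoning
  lemma : ∀ b a a′ → suc ((fromBool (not b) + 2 * a′) + (fromBool b + 2 * a)) ≡ 2 * suc (a′ + a)
  lemma true  = solve-∀
  lemma false = solve-∀
  go : ∀ n f → suc (fromBits n (λ i → not (f i)) + fromBits n f) ≡ 2 ^ n
  go zero    f = refl
  go (suc n) f = trans (lemma (f 0) (fromBits n (λ i → f (suc i))) _) (cong (2 *_) (go n (λ i → f (suc i))))

complement-+ : ∀ {a s} → s < 2 ^ bitLength a → complement a s + s ≡ 2 ^ bitLength a ∸ 1
complement-+ {a} {s} s<2^n rewrite ⊔-identityʳ s = begin
  fromBits n′ (λ i → not (testBit s i)) + s ≡⟨ cong (λ n → fromBits n (λ i → not (testBit s i)) + s) n′≡n ⟩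
  fromBits n (λ i → not (testBit s i)) + s                      ≡⟨ cong (fromBits n (λ i → not (testBit s i)) +_) (fromBits-testBit n s<2^n) ⟨
  fromBits n (λ i → not (testBit s i)) + fromBits n (testBit s) ≡⟨ fromBits-not n (testBit s) ⟩
  2 ^ n ∸ 1                                                     ∎
  where
  open ≡-Reasoning
  n n′ : ℕ
  n = bitLength a
  n′ = bitLength (a ⊔ s)
  n′≡n : n′ ≡ n
  n′≡n = ≤-antisym (bitLength-≤ n (a ⊔ s) (⊔-lub (<2^bitLength a) s<2^n)) (bitLength-mono-≤ (m≤m⊔n a s))

-- With n the bit length of a, negation sends z to 2 ^ n - 1 - z, so negating ¬a + b gives 2 ^ n - 1
-- - (2 ^ n - 1 - a + b) = a - b. Since b ≤ a, the inner sum keeps to n bits.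
complement-∸ : ∀ {a b} → b ≤ a → complement a (complement a a + b) ≡ a ∸ b
complement-∸ {a} {b} b≤a = +-cancelʳ-≡ s _ _ (begin
  complement a s + s               ≡⟨ complement-+ {a} {s} s<2^n ⟩
  2 ^ n ∸ 1                        ≡⟨ ¬a+a ⟨
  ¬a + a                           ≡⟨ cong (¬a +_) (m+[n∸m]≡n b≤a) ⟨
  ¬a + (b + (a ∸ b))               ≡⟨ +-assoc ¬a b (a ∸ b) ⟨
  s + (a ∸ b)                      ≡⟨ +-comm s (a ∸ b) ⟩
  (a ∸ b) + s                      ∎)
  where
  open ≡-Reasoning
  n ¬a s : ℕ
  n = bitLength a
  ¬a = complement a a
  s = ¬a + b
  ¬a+a : ¬a + a ≡ 2 ^ n ∸ 1
  ¬a+a = complement-+ {a} {a} (<2^bitLength a)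
  s<2^n : s < 2 ^ n
  s<2^n = ≤-<-trans (≤-trans (+-monoʳ-≤ ¬a b≤a) (≤-reflexive ¬a+a)) (2^n∸1<2^n n)

-- Concatenations of blocks of bits

concat : ℕ → ℕ → (ℕ → ℕ) → ℕ
concat W zero    a = 0
concat W (suc n) a = a 0 + 2 ^ W * concat W n (λ i → a (suc i))

concat-cong : ∀ W n {a b : ℕ → ℕ} → (∀ i → i < n → a i ≡ b i) → concat W n a ≡ concat W n b
concat-cong W zero    a≗b = refl
concat-cong W (suc n) a≗b =
  cong₂ (λ x y → x + 2 ^ W * y) (a≗b 0 z<s) (concat-cong W n λ i i<n → a≗b (suc i) (s<s i<n))

concat-< : ∀ W n {a} → (∀ i → i < n → a i < 2 ^ W) → concat W n a < 2 ^ (n * W)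
concat-< W zero    a<2^W = s≤s z≤n
concat-< W (suc n) a<2^W =
  ++-< W (n * W) (a<2^W 0 z<s) (concat-< W n λ i i<n → a<2^W (suc i) (s<s i<n))

testBit-concat : ∀ W n {a} → (∀ i → i < n → a i < 2 ^ W) → ∀ {i j} → i < n → j < W →
                 testBit (concat W n a) (i * W + j) ≡ testBit (a i) j
testBit-concat W (suc n) {a} a<2^W {zero}  {j} _   j<W = testBit-++-low W _ (a<2^W 0 z<s) j<W
testBit-concat W (suc n) {a} a<2^W {suc i} {j} (s≤s i<n) j<W = begin
  testBit (a 0 + 2 ^ W * rest) (W + i * W + j)   ≡⟨ cong (testBit (a 0 + 2 ^ W * rest)) (+-assoc W (i * W) j) ⟩
  testBit (a 0 + 2 ^ W * rest) (W + (i * W + j)) ≡⟨ testBit-++-high W rest (i * W + j) (a<2^W 0 z<s) ⟩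
  testBit rest (i * W + j)                       ≡⟨ testBit-concat W n (λ i i<n → a<2^W (suc i) (s<s i<n)) i<n j<W ⟩
  testBit (a (suc i)) j                          ∎
  where
  open ≡-Reasoning
  rest : ℕ
  rest = concat W n (λ i → a (suc i))

concat-+ : ∀ W n a b → concat W n a + concat W n b ≡ concat W n (λ i → a i + b i)
concat-+ W zero    a b = refl
concat-+ W (suc n) a b =
  trans (lemma (a 0) (b 0) (2 ^ W) (concat W n (λ i → a (suc i))) (concat W n (λ i → b (suc i))))
    (cong (λ c → a 0 + b 0 + 2 ^ W * c) (concat-+ W n (λ i → a (suc i)) (λ i → b (suc i))))
  where
  lemma : ∀ a b y c d → a + y * c + (b + y * d) ≡ a + b + y * (c + d)
  lemma = solve-∀

concat-* : ∀ W n a s → concat W n a * s ≡ concat W n (λ i → a i * s)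
concat-* W zero    a s = refl
concat-* W (suc n) a s = trans (lemma (a 0) (2 ^ W) (concat W n (λ i → a (suc i))) s)
  (cong (λ c → a 0 * s + 2 ^ W * c) (concat-* W n (λ i → a (suc i)) s))
  where
  lemma : ∀ a y c s → (a + y * c) * s ≡ a * s + y * (c * s)
  lemma = solve-∀

bitwise-concat : ∀ {k} (f : Vec Bool k → Bool) → f (Vec.replicate k false) ≡ false →
                 ∀ W n (φ : Fin k → ℕ → ℕ) → (∀ j i → i < n → φ j i < 2 ^ W) →
                 bitwise f (Vec.tabulate (λ j → concat W n (φ j))) ≡
                 concat W n (λ i → bitwise f (Vec.tabulate (λ j → φ j i)))
bitwise-concat f f0 W zero φ φ<2^W = n<1⇒n≡0 (bitwise-< f f0 0 (λ _ → 0) (λ _ → s≤s z≤n))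
bitwise-concat f f0 W (suc n) φ φ<2^W = trans
  (bitwise-++ f f0 W (λ j → φ j 0) _ (λ j → φ<2^W j 0 z<s))
  (cong (λ c → bitwise f (Vec.tabulate (λ j → φ j 0)) + 2 ^ W * c)
    (bitwise-concat f f0 W n (λ j i → φ j (suc i)) (λ j i i<n → φ<2^W j (suc i) (s<s i<n))))

2^≡suc : ∀ W → suc (2 ^ W ∸ 1) ≡ 2 ^ W
2^≡suc W = m+[n∸m]≡n (2^n>0 W)

-- The geometric series in y = 2 ^ W, that is b · Σ yⁱ · (y - 1) = b · (yⁿ - 1), with the negative
-- term moved across because subtraction truncates.
concat-const : ∀ W n b → concat W n (λ _ → b) * (2 ^ W ∸ 1) + b ≡ b * 2 ^ (W * n)
concat-const W n b = trans (go n) (cong (b *_) (^-*-assoc 2 W n))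
  where
  open ≡-Reasoning
  y z : ℕ
  y = 2 ^ W
  z = y ∸ 1
  lemma : ∀ b y c z → (b + y * c) * z + b ≡ b * suc z + y * (c * z)
  lemma = solve-∀
  lemma′ : ∀ b y c → b * y + y * c ≡ y * (c + b)
  lemma′ = solve-∀
  lemma″ : ∀ b y p → y * (b * p) ≡ b * (y * p)
  lemma″ = solve-∀
  go : ∀ n → concat W n (λ _ → b) * z + b ≡ b * y ^ n
  go zero    = sym (*-identityʳ b)
  go (suc n) = begin
    (b + y * concat W n (λ _ → b)) * z + b   ≡⟨ lemma b y (concat W n (λ _ → b)) z ⟩
    b * suc z + y * (concat W n (λ _ → b) * z) ≡⟨ cong (λ s → b * s + y * (concat W n (λ _ → b) * z)) (2^≡suc W) ⟩
    b * y + y * (concat W n (λ _ → b) * z)   ≡⟨ lemma′ b y (concat W n (λ _ → b) * z) ⟩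
    y * (concat W n (λ _ → b) * z + b)       ≡⟨ cong (y *_) (go n) ⟩
    y * (b * y ^ n)                          ≡⟨ lemma″ b y (y ^ n) ⟩
    b * y ^ suc n                            ∎

-- The sum Σ i·yⁱ telescopes; the induction needs the general Σ (i + k)·yⁱ.
concat-id : ∀ W n → concat W n (λ i → i) * (2 ^ W ∸ 1) + 2 ^ W * concat W n (λ _ → 1) ≡ n * 2 ^ (W * n)
concat-id W n = begin
  concat W n (λ i → i) * z + y * A n ≡⟨ cong (λ t → t * z + y * A n) (R′≡ n) ⟩
  R n 0 * z + y * A n       ≡⟨ cong (_+ y * A n) (+-identityʳ (R n 0 * z)) ⟨
  R n 0 * z + 0 + y * A n   ≡⟨ go n 0 ⟩
  (n + 0) * y ^ n           ≡⟨ cong₂ _*_ (+-identityʳ n) (^-*-assoc 2 W n) ⟩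
  n * 2 ^ (W * n)           ∎
  where
  open ≡-Reasoning
  y z : ℕ
  y = 2 ^ W
  z = y ∸ 1
  A : ℕ → ℕ
  A n = concat W n (λ _ → 1)
  R : ℕ → ℕ → ℕ
  R n k = concat W n (λ i → i + k)
  R′≡ : ∀ n → concat W n (λ i → i) ≡ R n 0
  R′≡ n = concat-cong W n (λ i _ → sym (+-identityʳ i))
  lemma : ∀ k y t z a → (k + y * t) * z + k + y * (1 + y * a) ≡ k * suc z + y * (t * z + 1 + y * a)
  lemma = solve-∀
  lemma′ : ∀ k y t a → k * y + y * (t + 1 + a) ≡ y * (t + suc k + a)
  lemma′ = solve-∀
  lemma″ : ∀ y n p → y * (n * p) ≡ n * (y * p)
  lemma″ = solve-∀
  go : ∀ n k → R n k * z + k + y * A n ≡ (n + k) * y ^ n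
  go zero    k = trans (cong (k +_) (*-zeroʳ y)) (trans (+-identityʳ k) (sym (*-identityʳ k)))
  go (suc n) k = begin
    (k + y * concat W n (λ i → suc i + k)) * z + k + y * (1 + y * A n) ≡⟨ cong (λ t → (k + y * t) * z + k + y * (1 + y * A n)) (concat-cong W n (λ i _ → sym (+-suc i k))) ⟩
    (k + y * R n (suc k)) * z + k + y * (1 + y * A n)   ≡⟨ lemma k y (R n (suc k)) z (A n) ⟩
    k * suc z + y * (R n (suc k) * z + 1 + y * A n)     ≡⟨ cong (λ s → k * s + y * (R n (suc k) * z + 1 + y * A n)) (2^≡suc W) ⟩
    k * y + y * (R n (suc k) * z + 1 + y * A n)         ≡⟨ lemma′ k y (R n (suc k) * z) (y * A n) ⟩
    y * (R n (suc k) * z + suc k + y * A n)             ≡⟨ cong (y *_) (go n (suc k)) ⟩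
    y * ((n + suc k) * y ^ n)                           ≡⟨ lemma″ y (n + suc k) (y ^ n) ⟩
    (n + suc k) * y ^ suc n                             ≡⟨ cong (_* y ^ suc n) (+-suc n k) ⟩
    (suc n + k) * y ^ suc n                             ∎

exactDiv-* : ∀ q d → d ≢ 0 → exactDiv (q * d) d ≡ just q
exactDiv-* q zero      d≢0 = contradiction refl d≢0
exactDiv-* q d@(suc _) d≢0 rewrite m*n%n≡0 q d ⦃ _ ⦄ | m*n/n≡m q d ⦃ _ ⦄ = refl

-- Straight-line programs

≡ᵇ-refl : ∀ n → (n ≡ᵇ n) ≡ true
≡ᵇ-refl zero    = refl
≡ᵇ-refl (suc n) = ≡ᵇ-refl n

≢⇒≡ᵇ-false : ∀ {m n} → m ≢ n → (m ≡ᵇ n) ≡ false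
≢⇒≡ᵇ-false {m} {n} m≢n with m ≡ᵇ n in eq
... | true  = contradiction (≡ᵇ⇒≡ m n (subst T (sym eq) _)) m≢n
... | false = refl

≔-same : ∀ R i v → (R [ i ≔ v ]) i ≡ v
≔-same R i v rewrite ≡ᵇ-refl i = refl

≔-other : ∀ R {i j} v → j ≢ i → (R [ i ≔ v ]) j ≡ R j
≔-other R v j≢i rewrite ≢⇒≡ᵇ-false j≢i = refl

open OpSet [+,/,←,Bool]
open PlusDivShiftBool using (add; div; shl; bool)

Code : Set
Code = Program [+,/,←,Bool]

-- Execution of assignments alone, free of labels. It composes under `_++_`, whereas `_⊢_,_⇓[_]_`
-- fixes the whole program and follows a run to its halt.
data _⊢_⟶_ : Code → Registers → Registers → Set where
  []  : ∀ {R} → [] ⊢ R ⟶ R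
  _∷_ : ∀ {i o as w cs R R′} → apply o (Vec.map (value R) as) ≡ just w →
        cs ⊢ R [ i ≔ w ] ⟶ R′ → (assign i o as ∷ cs) ⊢ R ⟶ R′

⟶-++ : ∀ {cs ds R R′ R″} → cs ⊢ R ⟶ R′ → ds ⊢ R′ ⟶ R″ → (cs ++ ds) ⊢ R ⟶ R″
⟶-++ []       q = q
⟶-++ (e ∷ p) q = e ∷ ⟶-++ p q

fetch-++ : ∀ (P : Code) c Q → fetch (P ++ c ∷ Q) (suc (length P)) ≡ just c
fetch-++ []          c Q = refl
fetch-++ (_ ∷ [])    c Q = refl
fetch-++ (_ ∷ P@(_ ∷ _)) c Q = fetch-++ P c Q

-- The prefix `P` absorbs the executed commands one at a time, so the current label is always one
-- more than its length.
⟶⇒⇓ : ∀ P cs Q {R R′ t v} → cs ⊢ R ⟶ R′ →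
      (P ++ cs ++ Q) ⊢ suc (length P + length cs) , R′ ⇓[ t ] v →
      (P ++ cs ++ Q) ⊢ suc (length P) , R ⇓[ length cs + t ] v
⟶⇒⇓ P [] Q [] run = subst (λ l → (P ++ Q) ⊢ suc l , _ ⇓[ _ ] _) (+-identityʳ (length P)) run
⟶⇒⇓ P (c ∷ cs) Q {R} {R′} {t} {v} (e ∷ p) run = assign (fetch-++ P c (cs ++ Q)) e next
  where
  P′ : Code
  P′ = P ++ c ∷ []
  assoc : P′ ++ cs ++ Q ≡ P ++ c ∷ cs ++ Q
  assoc = ++-assoc P (c ∷ []) (cs ++ Q)
  len : length P′ ≡ suc (length P)
  len = trans (length-++ P) (+-comm (length P) 1)
  next : (P ++ c ∷ cs ++ Q) ⊢ suc (suc (length P)) , _ ⇓[ length cs + t ] v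
  next = subst₂ (λ X l → X ⊢ suc l , _ ⇓[ length cs + t ] v) assoc len
    (⟶⇒⇓ P′ cs Q p (subst₂ (λ X l → X ⊢ suc l , R′ ⇓[ t ] v) (sym assoc)
      (trans (+-suc (length P) (length cs)) (cong (_+ length cs) (sym len))) run))

-- Indexed by the value as a function of the input and the auxiliary number. Each node carries a
-- proof that its operation is defined at all arguments, so exact division enters only with a proof
-- of divisibility and compiled code cannot get stuck.
data Expr : (ℕ → ℕ → ℕ) → Set where
  leaf : ∀ a {ψ} → (∀ R → value R a ≡ ψ (R 0) (R 1)) → Expr ψ
  op   : ∀ o {φ : Fin (arity o) → ℕ → ℕ → ℕ} {ψ} → (∀ j → Expr (φ j)) →
            (∀ inp x → apply o (Vec.tabulate (λ j → φ j inp x)) ≡ just (ψ inp x)) → Expr ψ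

compileArgs : ∀ k → (Fin k → ℕ → Code) → ℕ → Code
compileArgs zero    cs r = []
compileArgs (suc k) cs r = cs zero r ++ compileArgs k (λ j → cs (suc j)) (suc r)

-- The value of an expression goes to register r; the registers below r are preserved.
compile : ∀ {φ} → Expr φ → ℕ → Code
-- There is no transfer command; adding 0 takes its place.
compile (leaf a _) r = assign r add (a ∷ 𝟎 ∷ []) ∷ []
compile (op o es _) r =
  compileArgs (arity o) (λ j → compile (es j)) r ++
  assign r o (Vec.tabulate (λ j → reg (r + toℕ j))) ∷ []

Agree : ℕ → Registers → Registers → Set
Agree r R R′ = ∀ k → k < r → R′ k ≡ R k

Computes : Code → ℕ → ℕ → Registers → Set
Computes cs r v R = ∃[ R′ ] cs ⊢ R ⟶ R′ × R′ r ≡ v × Agree r R R′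

-- Argument j goes to register r + j and later arguments write only upwards, so earlier ones
-- survive. The hypothesis admits every register file that agrees below `r`, where the two inputs
-- will sit.
compileArgs-correct :
  ∀ k (cs : Fin k → ℕ → Code) (v : Fin k → ℕ) r R →
  (∀ j r′ R′ → r ≤ r′ → Agree r R R′ → Computes (cs j r′) r′ (v j) R′) →
  ∃[ R′ ] compileArgs k cs r ⊢ R ⟶ R′ × (∀ j → R′ (r + toℕ j) ≡ v j) × Agree r R R′
compileArgs-correct zero    cs v r R correct = R , [] , (λ ()) , λ _ _ → refl
compileArgs-correct (suc k) cs v r R correct =
  let R₁ , p , v₀ , R₁≗R = correct zero r R ≤-refl (λ _ _ → refl)
      R₂ , q , vs , R₂≗R₁ = compileArgs-correct k (λ j → cs (suc j)) (λ j → v (suc j)) (suc r) R₁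
        λ j r′ R′ r<r′ R′≗R₁ → correct (suc j) r′ R′ (<⇒≤ r<r′) λ i i<r → trans (R′≗R₁ i (m<n⇒m<1+n i<r)) (R₁≗R i i<r)
      values : ∀ j → R₂ (r + toℕ j) ≡ v j
      values = λ where
        zero    → trans (cong R₂ (+-identityʳ r)) (trans (R₂≗R₁ r (n<1+n r)) v₀)
        (suc j) → trans (cong R₂ (+-suc r (toℕ j))) (vs j)
  in R₂ , ⟶-++ p q , values , λ i i<r → trans (R₂≗R₁ i (m<n⇒m<1+n i<r)) (R₁≗R i i<r)

compile-correct : ∀ {ψ} (e : Expr ψ) r R → 2 ≤ r → Computes (compile e r) r (ψ (R 0) (R 1)) R
compile-correct (leaf a defined) r R 2≤r =
  _ , refl ∷ [] , trans (≔-same R r _) (trans (+-identityʳ (value R a)) (defined R)) ,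
  λ k k<r → ≔-other R _ (<⇒≢ k<r)
compile-correct (op o {φ} {ψ} es defined) r R 2≤r
  with R₁ , p , vs , R₁≗R ← compileArgs-correct (arity o) (λ j → compile (es j)) (λ j → φ j (R 0) (R 1)) r R
         (λ j r′ R′ r≤r′ R′≗R → subst₂ (λ i x → Computes (compile (es j) r′) r′ (φ j i x) R′)
            (R′≗R 0 (<-≤-trans z<s 2≤r)) (R′≗R 1 2≤r)
            (compile-correct (es j) r′ R′ (≤-trans 2≤r r≤r′)))
  = R₁ [ r ≔ w ] , ⟶-++ p (trans (cong (apply o) values) (defined (R 0) (R 1)) ∷ []) , ≔-same R₁ r w ,
    λ k k<r → trans (≔-other R₁ w (<⇒≢ k<r)) (R₁≗R k k<r)
  where
  w : ℕ
  w = ψ (R 0) (R 1)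
  values : Vec.map (value R₁) (Vec.tabulate (λ j → reg (r + toℕ j))) ≡ Vec.tabulate (λ j → φ j (R 0) (R 1))
  values = trans (sym (Vec.tabulate-∘ (value R₁) (λ j → reg (r + toℕ j)))) (Vec.tabulate-cong vs)

module _ {φ ψ} (e : Expr φ) (e′ : Expr ψ) (g : ℕ → ℕ → Bool)
         (g-correct : ∀ inp x → g inp x ≡ not (φ inp x ≡ᵇ ψ inp x)) where

  private
    code : Code
    code = compile e 2 ++ compile e′ 3

    tail : Label → Code
    -- Label l + 1 outputs 0 and label l + 3 outputs 1; register 0 still holds the input and has to
    -- be overwritten.
    tail l = compare (reg 2) (reg 3) (1 + l) (3 + l) ∷
      assign 0 add (𝟎 ∷ 𝟎 ∷ []) ∷ halt ∷
      assign 0 add (𝟏 ∷ 𝟎 ∷ []) ∷ halt ∷ []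

    P : Code
    P = code ++ tail (suc (length code))

    fetch-tail : ∀ (C D : Code) k → fetch (C ++ D) (length C + suc k) ≡ fetch D (suc k)
    fetch-tail []          D k = refl
    fetch-tail (c ∷ [])    D k = refl
    fetch-tail (c ∷ C@(_ ∷ _)) D k = fetch-tail C D k

    fetch-P : ∀ k {c} → fetch (tail (suc (length code))) (suc k) ≡ c → fetch P (suc (k + length code)) ≡ c
    fetch-P k eq = trans (cong (fetch P) (trans (cong suc (+-comm k (length code))) (sym (+-suc (length code) k))))
      (trans (fetch-tail code _ k) eq)

    run-tail : ∀ R → P ⊢ suc (length code) , R ⇓[ 3 ] fromBool (not (R 2 ≡ᵇ R 3))
    run-tail R with R 2 ≟ R 3
    ... | yes eq rewrite trans (cong (_≡ᵇ R 3) eq) (≡ᵇ-refl (R 3)) =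
      compare-≡ (fetch-P 0 refl) eq (assign (fetch-P 1 refl) refl (halt (fetch-P 2 refl)))
    ... | no neq rewrite ≢⇒≡ᵇ-false neq =
      compare-≢ (fetch-P 0 refl) neq (assign (fetch-P 3 refl) refl (halt (fetch-P 4 refl)))

  -- The code has no branches before the final comparison, and either branch is an assignment and a
  -- halt: hence the 3, and a time independent of both inputs.
  ≢-computable : ∃[ c ] ComputableInTime [+,/,←,Bool] (λ _ → c) g
  ≢-computable = length code + 3 , P , λ inp x → length code + 3 , ≤-refl , run inp x
    where
    run : ∀ inp x → P on (inp ∷ x ∷ []) ⇓[ length code + 3 ] fromBool (g inp x)
    run inp x
      with R₁ , p , v , R₁≗R ← compile-correct e 2 (initial {[+,/,←,Bool]} (inp ∷ x ∷ [])) ≤-refl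
      with R₂ , q , v′ , R₂≗R₁ ← compile-correct e′ 3 R₁ (n≤1+n 2)
      = subst (λ b → P on (inp ∷ x ∷ []) ⇓[ length code + 3 ] fromBool b) value-g
          (⟶⇒⇓ [] code _ (⟶-++ p q) (run-tail R₂))
      where
      value-g : not (R₂ 2 ≡ᵇ R₂ 3) ≡ g inp x
      value-g = trans
        (cong₂ (λ a b → not (a ≡ᵇ b)) (trans (R₂≗R₁ 2 ≤-refl) v)
          (trans v′ (cong₂ ψ (R₁≗R 0 z<s) (R₁≗R 1 (s<s z<s)))))
        (sym (g-correct inp x))

-- Arithmetic within the available operations

private variable
  φ ψ χ : ℕ → ℕ → ℕ

pair : (a b : ℕ → ℕ → ℕ) → Fin 2 → ℕ → ℕ → ℕ
pair a b zero    = a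
pair a b (suc _) = b

pairᴱ : Expr φ → Expr ψ → ∀ j → Expr (pair φ ψ j)
pairᴱ e e′ zero    = e
pairᴱ e e′ (suc _) = e′

inpᴱ : Expr (λ inp x → inp)
inpᴱ = leaf (reg 0) (λ _ → refl)

auxᴱ : Expr (λ inp x → x)
auxᴱ = leaf (reg 1) (λ _ → refl)

0ᴱ : Expr (λ _ _ → 0)
0ᴱ = leaf 𝟎 (λ _ → refl)

1ᴱ : Expr (λ _ _ → 1)
1ᴱ = leaf 𝟏 (λ _ → refl)

infixl 6 _+ᴱ_ _∸ᴱ_⟨_⟩
infixl 7 _*2^_

_+ᴱ_ : Expr φ → Expr ψ → Expr (λ i x → φ i x + ψ i x)
e +ᴱ e′ = op add (pairᴱ e e′) (λ _ _ → refl)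

_*2^_ : Expr φ → Expr ψ → Expr (λ i x → φ i x * 2 ^ ψ i x)
e *2^ e′ = op shl (pairᴱ e e′) (λ _ _ → refl)

2^ᴱ_ : Expr φ → Expr (λ i x → 2 ^ φ i x)
2^ᴱ e = op shl (pairᴱ 1ᴱ e) (λ _ _ → cong just (+-identityʳ _))

-- The factor is fixed when the program is written, so repeated addition has constant cost.
_*ᴱ_ : ∀ k → Expr φ → Expr (λ i x → k * φ i x)
zero  *ᴱ e = 0ᴱ
suc k *ᴱ e = e +ᴱ (k *ᴱ e)

boolᴱ : ∀ {k} (f : Vec Bool k → Bool) {φ : Fin k → ℕ → ℕ → ℕ} → (∀ j → Expr (φ j)) →
        Expr (λ i x → bitwise f (Vec.tabulate (λ j → φ j i x)))
boolᴱ {k} f es = op (bool k f) es (λ _ _ → refl)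

_∸ᴱ_⟨_⟩ : Expr φ → Expr ψ → (∀ i x → ψ i x ≤ φ i x) → Expr (λ i x → φ i x ∸ ψ i x)
_∸ᴱ_⟨_⟩ {φ} {ψ} e e′ ψ≤φ =
  op (bool 2 not₂) (pairᴱ e (boolᴱ not₂ (pairᴱ e e) +ᴱ e′))
    (λ i x → cong just (complement-∸ (ψ≤φ i x)))
  where
  not₂ : Vec Bool 2 → Bool
  not₂ v = not (Vec.lookup v (suc zero))

2^_∸1ᴱ : Expr φ → Expr (λ i x → 2 ^ φ i x ∸ 1)
2^_∸1ᴱ {φ} e = (2^ᴱ e) ∸ᴱ 1ᴱ ⟨ (λ i x → 2^n>0 (φ i x)) ⟩

_/ᴱ_⟨_,_⟩ : Expr φ → Expr ψ → (∀ i x → χ i x * ψ i x ≡ φ i x) → (∀ i x → ψ i x ≢ 0) → Expr χ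
_/ᴱ_⟨_,_⟩ {φ} {ψ} {χ} e e′ exact ψ≢0 = op div (pairᴱ e e′) λ i x →
  trans (cong (λ a → exactDiv a (ψ i x)) (sym (exact i x))) (exactDiv-* (χ i x) (ψ i x) (ψ≢0 i x))

m+n≡o⇒m≡o∸n : ∀ {m n o} → m + n ≡ o → m ≡ o ∸ n
m+n≡o⇒m≡o∸n {m} {n} eq = trans (sym (m+n∸n≡m m n)) (cong (_∸ n) eq)

2^n∸1≢0 : ∀ {n} → 0 < n → 2 ^ n ∸ 1 ≢ 0
2^n∸1≢0 {n} 0<n eq = <⇒≢ (2^-mono-< 0<n) (sym (trans (sym (2^≡suc n)) (cong suc eq)))

-- The closed form of `concat-const`, divided by 2 ^ W - 1. The number of blocks is a power of two
-- so that the exponent W · 2 ^ n is itself a shift; `0<W` keeps the divisor from being 0.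
repeatᴱ : ∀ {W n b} → Expr W → Expr n → Expr b → (∀ i x → 0 < W i x) →
          Expr (λ i x → concat (W i x) (2 ^ n i x) (λ _ → b i x))
repeatᴱ {W} {n} {b} eW en eb 0<W =
  (eb *2^ (eW *2^ en) ∸ᴱ eb ⟨ (λ i x → subst (b i x ≤_) (closed i x) (m≤n+m _ _)) ⟩)
    /ᴱ 2^ eW ∸1ᴱ ⟨ (λ i x → m+n≡o⇒m≡o∸n (closed i x)) , (λ i x → 2^n∸1≢0 (0<W i x)) ⟩
  where
  closed : ∀ i x → concat (W i x) (2 ^ n i x) (λ _ → b i x) * (2 ^ W i x ∸ 1) + b i x ≡
                   b i x * 2 ^ (W i x * 2 ^ n i x)
  closed i x = concat-const (W i x) (2 ^ n i x) (b i x)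

-- With y = 2 ^ W and m = 2 ^ n blocks, Σ i·yⁱ = (m·yᵐ - y·Σ yⁱ) / (y - 1), which is `concat-id`
-- solved for the sum.
iotaᴱ : ∀ {W n} → Expr W → Expr n → (∀ i x → 0 < W i x) →
        Expr (λ i x → concat (W i x) (2 ^ n i x) (λ j → j))
iotaᴱ {W} {n} eW en 0<W =
  ((2^ᴱ en) *2^ (eW *2^ en) ∸ᴱ repeatᴱ eW en 1ᴱ 0<W *2^ eW ⟨ (λ i x → subst (A i x ≤_) (closed i x) (m≤n+m _ _)) ⟩)
    /ᴱ 2^ eW ∸1ᴱ ⟨ (λ i x → m+n≡o⇒m≡o∸n (closed i x)) , (λ i x → 2^n∸1≢0 (0<W i x)) ⟩
  where
  A : ℕ → ℕ → ℕ
  A i x = concat (W i x) (2 ^ n i x) (λ _ → 1) * 2 ^ W i x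
  closed : ∀ i x → concat (W i x) (2 ^ n i x) (λ j → j) * (2 ^ W i x ∸ 1) + A i x ≡
                   2 ^ n i x * 2 ^ (W i x * 2 ^ n i x)
  closed i x = trans
    (cong (concat (W i x) (2 ^ n i x) (λ j → j) * (2 ^ W i x ∸ 1) +_) (*-comm _ (2 ^ W i x)))
    (concat-id (W i x) (2 ^ n i x))

castᴱ : (∀ i x → φ i x ≡ ψ i x) → Expr φ → Expr ψ
castᴱ φ≗ψ (leaf a p)  = leaf a (λ R → trans (p R) (φ≗ψ (R 0) (R 1)))
castᴱ φ≗ψ (op o es p) = op o es (λ i x → trans (p i x) (cong just (φ≗ψ i x)))

-- The default false suits the later reading of register bits: registers outside the stored range
-- hold 0.
at : ∀ {n} → Vec Bool n → ℕ → Bool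
at []      _       = false
at (b ∷ _) zero    = b
at (_ ∷ v) (suc i) = at v i

at-toℕ : ∀ {n} (v : Vec Bool n) i → at v (toℕ i) ≡ Vec.lookup v i
at-toℕ (b ∷ v) zero    = refl
at-toℕ (b ∷ v) (suc i) = at-toℕ v i

_≟ᵛ_ : ∀ {n} (u v : Vec Bool n) → Dec (u ≡ v)
_≟ᵛ_ = Vec.≡-dec Bool._≟_

-- Tableaux

-- The successor rules take the preceding cell in reading order and, from the second row on, the
-- cell above; the flag of step tells whether the cell is the first of its row.
record Rule (K : ℕ) : Set where
  field
    first  : Bool → Vec Bool K
    load   : Bool → Vec Bool K → Vec Bool K
    step   : Bool → Vec Bool K → Vec Bool K → Vec Bool K
    accept : Vec Bool K → Bool

  module _ (c′ : ℕ) (β : ℕ → Bool) where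
    tableau : ℕ → ℕ → Vec Bool K
    tableau zero    zero    = first (β 0)
    tableau zero    (suc j) = load (β (suc j)) (tableau zero j)
    tableau (suc τ) zero    = step true (tableau τ c′) (tableau τ 0)
    tableau (suc τ) (suc j) = step false (tableau (suc τ) j) (tableau τ (suc j))

  next : (d z ι : Bool) → Vec Bool K → Vec Bool K → Vec Bool K
  next true  true  ι prev above = first ι
  next false true  ι prev above = load ι prev
  next d     false ι prev above = step d prev above

pattern valid = zero
pattern final = suc zero
pattern left  = suc (suc zero)
pattern top   = suc (suc (suc zero))
pattern input = suc (suc (suc (suc zero)))
pattern here  = zero
pattern prev  = suc zero
pattern above = suc (suc zero)

-- Local correctness of candidate tableaux

module Check {K : ℕ} (rule : Rule K) where
  open Rule rule

  -- Five masks (cell positions, the position after the last cell, row starts, first row, input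
  -- bits) and three displaced copies for each of the `K` bits of a cell.
  Index : Set
  Index = Fin 5 ⊎ (Fin 3 × Fin K)

  size : ℕ
  size = 5 + 3 * K

  decode : Fin size → Index
  decode j with splitAt 5 j
  ... | inj₁ m = inj₁ m
  ... | inj₂ w = inj₂ (remQuot K w)

  encode : Index → Fin size
  encode (inj₁ m)       = m ↑ˡ (3 * K)
  encode (inj₂ (d , k)) = 5 ↑ʳ combine d k

  decode-encode : ∀ t → decode (encode t) ≡ t
  decode-encode (inj₁ m) rewrite splitAt-↑ˡ 5 m (3 * K) = refl
  decode-encode (inj₂ (d , k)) rewrite splitAt-↑ʳ 5 (3 * K) (combine d k) = cong inj₂ (remQuot-combine d k)

  cells : Fin 3 → (Index → Bool) → Vec Bool K
  cells d β = Vec.tabulate (λ k → β (inj₂ (d , k)))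

  -- The halt test sits one position past the last cell, where the window of the preceding cell
  -- shows exactly that cell.
  wrong : (Index → Bool) → Bool
  wrong β =
    (β (inj₁ valid) ∧
      not (does (cells here β ≟ᵛ
                 next (β (inj₁ left)) (β (inj₁ top)) (β (inj₁ input)) (cells prev β) (cells above β)))) ∨
    (β (inj₁ final) ∧ not (accept (cells prev β)))

  wrong-cong : ∀ {β γ} → (∀ t → β t ≡ γ t) → wrong β ≡ wrong γ
  wrong-cong {β} {γ} β≗γ
    rewrite β≗γ (inj₁ valid) | β≗γ (inj₁ final) | β≗γ (inj₁ left) | β≗γ (inj₁ top) | β≗γ (inj₁ input)
          | Vec.tabulate-cong {f = λ k → β (inj₂ (here , k))} (λ k → β≗γ (inj₂ (here , k)))
          | Vec.tabulate-cong {f = λ k → β (inj₂ (prev , k))} (λ k → β≗γ (inj₂ (prev , k)))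
          | Vec.tabulate-cong {f = λ k → β (inj₂ (above , k))} (λ k → β≗γ (inj₂ (above , k))) = refl

  check : Vec Bool size → Bool
  check v = wrong (λ t → Vec.lookup v (encode t))

  check-tabulate : ∀ β → check (Vec.tabulate (β ∘ decode)) ≡ wrong β
  check-tabulate β = wrong-cong λ t → trans (Vec.lookup∘tabulate (β ∘ decode) (encode t)) (cong β (decode-encode t))

  wrong-outside : ∀ β → β (inj₁ valid) ≡ false → β (inj₁ final) ≡ false → wrong β ≡ false
  wrong-outside β v f rewrite v | f = refl

  wrong-inside : ∀ β → β (inj₁ valid) ≡ true → β (inj₁ final) ≡ false → ∀ {u w} → cells here β ≡ u →
                 next (β (inj₁ left)) (β (inj₁ top)) (β (inj₁ input)) (cells prev β) (cells above β) ≡ w →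
                 wrong β ≡ not (does (u ≟ᵛ w))
  wrong-inside β v f refl refl rewrite v | f = Bool.∨-identityʳ _

  wrong-final : ∀ β → β (inj₁ valid) ≡ false → β (inj₁ final) ≡ true → ∀ {u} → cells prev β ≡ u →
                wrong β ≡ not (accept u)
  wrong-final β v f refl rewrite v | f = refl

  -- Nothing is wrong where `valid` and `final` are both off. For all-false bits this is the
  -- condition under which bitwise operations act block by block.
  check-0 : check (Vec.replicate size false) ≡ false
  check-0 = wrong-outside (λ t → Vec.lookup (Vec.replicate size false) (encode t)) (Vec.lookup-replicate (encode (inj₁ valid)) false)
                          (Vec.lookup-replicate (encode (inj₁ final)) false)

  -- Candidate i holds bit k of the cell at position p in its bit (k+1)·L + p.  The three
  -- shifts in word bring this bit to M + p, M + p + 1 and M + p + c, so that at M + p the bits of the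
  -- cell, of the preceding cell and of the cell above are aligned.
  module Lane (c′ rows′ inp : ℕ) (inp<2^c : inp < 2 ^ suc c′) where

    c rows L M B : ℕ
    c = suc c′
    rows = suc rows′
    L = rows * c
    M = suc K * L
    -- Shifted masks have at most L + 1 + M bits and displaced candidates at most 2 · M; this covers
    -- both.
    B = suc (M + M)

    offset : Fin 3 → ℕ
    offset here  = 0
    offset prev  = 1
    offset above = c

    mask : Fin 5 → ℕ
    mask valid = 2 ^ L ∸ 1
    mask final = 2 ^ L
    mask left  = concat c rows (λ _ → 1)
    mask top   = 2 ^ c ∸ 1
    mask input = inp

    word : Index → ℕ → ℕ
    word (inj₁ m)       i = mask m * 2 ^ M
    word (inj₂ (d , k)) i = i * 2 ^ ((K ∸ toℕ k) * L + offset d)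

    errors : ℕ → ℕ
    errors i = bitwise check (Vec.tabulate (λ j → word (decode j) i))

    c≤L : c ≤ L
    c≤L = m≤m+n c (rows′ * c)

    offset≤L : ∀ d → offset d ≤ L
    offset≤L here  = z≤n
    offset≤L prev  = s≤s z≤n
    offset≤L above = c≤L

    mask< : ∀ m → mask m < 2 ^ suc L
    mask< valid = <-trans (2^n∸1<2^n L) (2^-mono-< (n<1+n L))
    mask< final = 2^-mono-< (n<1+n L)
    mask< left  = <-trans (concat-< c rows {λ _ → 1} (λ _ _ → 2^-mono-< {0} {c} z<s)) (2^-mono-< (n<1+n L))
    mask< top   = <-≤-trans (2^n∸1<2^n c) (2^-mono-≤ {c} (≤-trans c≤L (n≤1+n L)))
    mask< input = <-≤-trans inp<2^c (2^-mono-≤ {c} (≤-trans c≤L (n≤1+n L)))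

    word-< : ∀ t i → i < 2 ^ M → word t i < 2 ^ B
    word-< (inj₁ m)       i i<2^M = shl-< (suc L) M (mask< m) (s≤s (+-monoˡ-≤ M (m≤m+n L (K * L))))
    word-< (inj₂ (d , k)) i i<2^M = shl-< M ((K ∸ toℕ k) * L + offset d) i<2^M
      (≤-trans (+-monoʳ-≤ M (≤-trans (+-mono-≤ (*-monoˡ-≤ L (m∸n≤m K (toℕ k))) (offset≤L d))
        (≤-reflexive (+-comm (K * L) L)))) (n≤1+n (M + M)))

    errors-< : ∀ i → i < 2 ^ M → errors i < 2 ^ B
    errors-< i i<2^M = bitwise-< check check-0 B _ (λ j → word-< (decode j) i i<2^M)

    module _ (i : ℕ) where

      cell : ℕ → Vec Bool K
      cell p = Vec.tabulate (λ k → testBit i (suc (toℕ k) * L + p))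

      bits : ℕ → Index → Bool
      bits q t = testBit (word t i) q

      testBit-errors : ∀ q → testBit (errors i) q ≡ wrong (bits q)
      testBit-errors q = trans (testBit-bitwise check check-0 (λ j → word (decode j) i) q) (check-tabulate (bits q))

      mask-bit : ∀ m p → bits (M + p) (inj₁ m) ≡ testBit (mask m) p
      mask-bit m p = testBit-shl-high (mask m) M p

      window : ∀ d {p q} → q ≡ offset d + p → cells d (bits (M + q)) ≡ cell p
      window d {p} refl = Vec.tabulate-cong λ k → trans
        (cong (testBit (word (inj₂ (d , k)) i)) (split (toℕ k) (toℕ<n k)))
        (testBit-shl-high i ((K ∸ toℕ k) * L + offset d) (suc (toℕ k) * L + p))
        where
        lemma : ∀ a k l o p → l + (k + a) * l + (o + p) ≡ (a * l + o) + (l + k * l + p)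
        lemma = solve-∀
        split : ∀ k → k < K → M + (offset d + p) ≡ ((K ∸ k) * L + offset d) + (suc k * L + p)
        split k k<K = trans (cong (λ n → L + n * L + (offset d + p)) (sym (m+[n∸m]≡n (<⇒≤ k<K))))
          (lemma (K ∸ k) k L (offset d) p)

      -- What the rule demands of a cell, computed from the candidate's own cells and not from the
      -- tableau.
      successor : ℕ → ℕ → Vec Bool K
      successor zero    zero    = first (testBit inp 0)
      successor zero    (suc j) = load (testBit inp (suc j)) (cell j)
      successor (suc τ) zero    = step true (cell (τ * c + c′)) (cell (τ * c + 0))
      successor (suc τ) (suc j) = step false (cell (suc τ * c + j)) (cell (τ * c + suc j))

      position< : ∀ {τ j} → τ < rows → j < c → τ * c + j < L
      position< {τ} {j} τ<rows j<c = begin-strict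
        τ * c + j   <⟨ +-monoʳ-< (τ * c) j<c ⟩
        τ * c + c   ≡⟨ +-comm (τ * c) c ⟩
        suc τ * c   ≤⟨ *-monoˡ-≤ c τ<rows ⟩
        L           ∎
        where open ≤-Reasoning

      left-bit : ∀ {τ} j → τ < rows → j < c → bits (M + (τ * c + j)) (inj₁ left) ≡ (j ≡ᵇ 0)
      left-bit {τ} j τ<rows j<c = trans (mask-bit left (τ * c + j))
        (trans (testBit-concat c rows {λ _ → 1} (λ _ _ → 2^-mono-< {0} {c} z<s) τ<rows j<c) (bit j))
        where
        bit : ∀ j → testBit 1 j ≡ (j ≡ᵇ 0)
        bit zero    = refl
        bit (suc j) = testBit-zero j

      top-bit-0 : ∀ {j} → j < c → bits (M + j) (inj₁ top) ≡ true
      top-bit-0 {j} j<c = trans (mask-bit top j) (testBit-ones c j<c)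

      top-bit-suc : ∀ τ j → bits (M + (suc τ * c + j)) (inj₁ top) ≡ false
      top-bit-suc τ j = trans (mask-bit top (suc τ * c + j))
        (testBit-≥ c (2^n∸1<2^n c) (≤-trans (m≤m+n c (τ * c)) (m≤m+n (suc τ * c) j)))

      final-bit-low : ∀ {p} → p < L → bits (M + p) (inj₁ final) ≡ false
      final-bit-low {p} p<L = trans (mask-bit final p)
        (trans (cong (λ a → testBit a p) (sym (*-identityˡ (2 ^ L)))) (testBit-shl-low 1 L p<L))

      errors-inside : ∀ τ j → τ < rows → j < c →
                      testBit (errors i) (M + (τ * c + j)) ≡ not (does (cell (τ * c + j) ≟ᵛ successor τ j))
      errors-inside τ j τ<rows j<c = trans (testBit-errors (M + (τ * c + j)))
        (wrong-inside (bits (M + (τ * c + j))) (trans (mask-bit valid (τ * c + j)) (testBit-ones L (position< τ<rows j<c)))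
          (final-bit-low (position< τ<rows j<c)) (window here refl) (next-successor τ j τ<rows j<c))
        where
        next-successor : ∀ τ j → τ < rows → j < c → let β = bits (M + (τ * c + j)) in
          next (β (inj₁ left)) (β (inj₁ top)) (β (inj₁ input)) (cells prev β) (cells above β) ≡ successor τ j
        next-successor zero zero _ j<c
          rewrite left-bit {0} 0 z<s z<s | top-bit-0 {0} j<c | mask-bit input 0 = refl
        next-successor zero (suc j) _ j<c
          rewrite left-bit {0} (suc j) z<s j<c | top-bit-0 j<c | mask-bit input (suc j)
          = cong (load (testBit inp (suc j))) (window prev refl)
        next-successor (suc τ) zero τ<rows j<c
          rewrite left-bit {suc τ} 0 τ<rows j<c | top-bit-suc τ 0
          -- In reading order the first cell of a row is preceded by the last cell of the row above.
          = cong₂ (step true) (window prev (lemma c′ (τ * c))) (window above (+-assoc c (τ * c) 0))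
          where
          lemma : ∀ c′ t → suc c′ + t + 0 ≡ 1 + (t + c′)
          lemma = solve-∀
        next-successor (suc τ) (suc j) τ<rows j<c
          rewrite left-bit {suc τ} (suc j) τ<rows j<c | top-bit-suc τ (suc j)
          = cong₂ (step false) (window prev (+-suc (suc τ * c) j)) (window above (+-assoc c (τ * c) (suc j)))

      errors-final : testBit (errors i) (M + L) ≡ not (accept (cell (rows′ * c + c′)))
      errors-final = trans (testBit-errors (M + L)) (wrong-final (bits (M + L))
        (trans (mask-bit valid L) (testBit-≥ L (2^n∸1<2^n L) ≤-refl))
        (trans (mask-bit final L) (trans (cong₂ testBit (sym (*-identityˡ (2 ^ L))) (sym (+-identityʳ L)))
          (testBit-shl-high 1 L 0)))
        (window prev (cong suc (+-comm c′ (rows′ * c)))))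

      Follows : Set
      Follows = ∀ τ j → τ < rows → j < c → cell (τ * c + j) ≡ tableau c′ (testBit inp) τ j

      -- Induction in reading order: the rule determines each cell from earlier ones, so the absence
      -- of local faults forces the whole tableau.
      errors≡0⇒follows : errors i ≡ 0 → Follows
      errors≡0⇒follows eq = go
        where
        eqn : ∀ τ j → τ < rows → j < c → cell (τ * c + j) ≡ successor τ j
        eqn τ j τ<rows j<c with cell (τ * c + j) ≟ᵛ successor τ j | errors-inside τ j τ<rows j<c
        ... | yes p | _ = p
        ... | no  _ | q with () ← trans (sym (testBit-zero (M + (τ * c + j))))
                (trans (cong (λ a → testBit a (M + (τ * c + j))) (sym eq)) q)
        go : Follows
        go zero zero τ< j< = eqn 0 0 τ< j<
        go zero (suc j) τ< j< = trans (eqn 0 (suc j) τ< j<)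
          (cong (load (testBit inp (suc j))) (go zero j τ< (<⇒≤ j<)))
        go (suc τ) zero τ< j< = trans (eqn (suc τ) 0 τ< j<)
          (cong₂ (step true) (go τ c′ (<⇒≤ τ<) (n<1+n c′)) (go τ 0 (<⇒≤ τ<) j<))
        go (suc τ) (suc j) τ< j< = trans (eqn (suc τ) (suc j) τ< j<)
          (cong₂ (step false) (go (suc τ) j τ< (<⇒≤ j<)) (go τ (suc j) (<⇒≤ τ<) j<))

      errors≡0⇒accept : errors i ≡ 0 → accept (tableau c′ (testBit inp) rows′ c′) ≡ true
      errors≡0⇒accept eq = trans (cong accept (sym (errors≡0⇒follows eq rows′ c′ (n<1+n rows′) (n<1+n c′))))
        (not-false (trans (sym errors-final) (trans (cong (λ a → testBit a (M + L)) eq) (testBit-zero (M + L)))))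
        where
        not-false : ∀ {b} → not b ≡ false → b ≡ true
        not-false {true} _ = refl

      -- Four ranges of bits: below M and beyond M + L both `valid` and `final` are off, at the L
      -- cell positions the local rule holds, and at M + L the halt test succeeds.
      follows⇒errors≡0 : Follows → accept (tableau c′ (testBit inp) rows′ c′) ≡ true → errors i ≡ 0
      follows⇒errors≡0 follows acc = testBit-injective λ q → trans (no-error q) (sym (testBit-zero q))
        where
        eqn : ∀ τ j → τ < rows → j < c → cell (τ * c + j) ≡ successor τ j
        eqn zero zero τ< j< = follows 0 0 τ< j<
        eqn zero (suc j) τ< j< = trans (follows 0 (suc j) τ< j<)
          (cong (load (testBit inp (suc j))) (sym (follows zero j τ< (<⇒≤ j<))))
        eqn (suc τ) zero τ< j< = trans (follows (suc τ) 0 τ< j<)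
          (cong₂ (step true) (sym (follows τ c′ (<⇒≤ τ<) (n<1+n c′))) (sym (follows τ 0 (<⇒≤ τ<) j<)))
        eqn (suc τ) (suc j) τ< j< = trans (follows (suc τ) (suc j) τ< j<)
          (cong₂ (step false) (sym (follows (suc τ) j τ< (<⇒≤ j<))) (sym (follows τ (suc j) (<⇒≤ τ<) j<)))
        inside : ∀ p → p < L → testBit (errors i) (M + p) ≡ false
        inside p p<L = subst (λ p → testBit (errors i) (M + p) ≡ false)
          (trans (+-comm (p / c * c) (p % c)) (sym (m≡m%n+[m/n]*n p c)))
          (trans (errors-inside (p / c) (p % c) τ<rows j<c) (cong not (dec-true (_ ≟ᵛ _) (eqn (p / c) (p % c) τ<rows j<c))))
          where
          τ<rows : p / c < rows
          τ<rows = m<n*o⇒m/o<n p<L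
          j<c : p % c < c
          j<c = m%n<n p c
        beyond : ∀ r → bits (M + suc (L + r)) (inj₁ valid) ≡ false × bits (M + suc (L + r)) (inj₁ final) ≡ false
        beyond r =
          trans (mask-bit valid (suc (L + r))) (testBit-≥ (suc L) (mask< valid) (s≤s (m≤m+n L r))) ,
          trans (mask-bit final (suc (L + r))) (testBit-≥ (suc L) (mask< final) (s≤s (m≤m+n L r)))
        no-error : ∀ q → testBit (errors i) q ≡ false
        no-error q with q <? M
        ... | yes q<M = trans (testBit-errors q)
                (wrong-outside (bits q) (testBit-shl-low (mask valid) M q<M) (testBit-shl-low (mask final) M q<M))
        ... | no  q≮M with p , refl ← m≤n⇒∃[o]m+o≡n (≮⇒≥ q≮M) with p <? L
        ...   | yes p<L = inside p p<L
        ...   | no  p≮L with m≤n⇒∃[o]m+o≡n (≮⇒≥ p≮L)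
        ...     | zero  , refl = subst (λ p → testBit (errors i) (M + p) ≡ false) (sym (+-identityʳ L))
                    (trans errors-final (cong not (trans (cong accept (follows rows′ c′ (n<1+n rows′) (n<1+n c′))) acc)))
        ...     | suc r , refl = subst (λ p → testBit (errors i) (M + p) ≡ false) (sym (+-suc L r))
                    (trans (testBit-errors (M + suc (L + r))) (wrong-outside (bits (M + suc (L + r))) (proj₁ (beyond r)) (proj₂ (beyond r))))

    row : ℕ → ℕ → ℕ
    row k τ = fromBits c (λ j → at (tableau c′ (testBit inp) τ j) k)

    row-< : ∀ k τ → row k τ < 2 ^ c
    row-< k τ = fromBits-< c (λ j → at (tableau c′ (testBit inp) τ j) k)

    -- Plane 0 is left empty, as bit k of the cells starts at position (k + 1) · L.
    plane : ℕ → ℕ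
    plane zero    = 0
    plane (suc k) = concat c rows (row k)

    witness : ℕ
    witness = concat L (suc K) plane

    plane-< : ∀ k → plane k < 2 ^ L
    plane-< zero    = 2^n>0 L
    plane-< (suc k) = concat-< c rows (λ τ _ → row-< k τ)

    -- This bound places the correct filling among the 2 ^ M candidates.
    witness-< : witness < 2 ^ M
    witness-< = concat-< L (suc K) (λ k _ → plane-< k)

    witness-follows : Follows witness
    witness-follows τ j τ<rows j<c = trans (Vec.tabulate-cong bit) (Vec.tabulate∘lookup u)
      where
      u : Vec Bool K
      u = tableau c′ (testBit inp) τ j
      bit : ∀ k → testBit witness (suc (toℕ k) * L + (τ * c + j)) ≡ Vec.lookup u k
      bit k = begin
        testBit witness (suc (toℕ k) * L + (τ * c + j)) ≡⟨ testBit-concat L (suc K) (λ k _ → plane-< k) (s<s (toℕ<n k)) (position< witness τ<rows j<c) ⟩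
        testBit (plane (suc (toℕ k))) (τ * c + j)       ≡⟨ testBit-concat c rows (λ τ _ → row-< (toℕ k) τ) τ<rows j<c ⟩
        testBit (row (toℕ k) τ) j                       ≡⟨ testBit-fromBits c (λ j → at (tableau c′ (testBit inp) τ j) (toℕ k)) j<c ⟩
        at u (toℕ k)                                    ≡⟨ at-toℕ u k ⟩
        Vec.lookup u k                                  ∎
        where open ≡-Reasoning

-- Recognizing a zero block

both : Vec Bool 2 → Bool
both v = Vec.lookup v zero ∧ Vec.lookup v (suc zero)

operands : ℕ → ℕ → Fin 2 → ℕ
operands a b zero    = a
operands a b (suc _) = b

-- Adding 2 ^ B ∸ 1 carries into bit B exactly when e is nonzero.
flag : ℕ → ℕ → ℕ
flag B e = bitwise both (Vec.tabulate (operands (e + (2 ^ B ∸ 1)) (2 ^ B)))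

testBit-flag : ∀ B e q → testBit (flag B e) q ≡ testBit (e + (2 ^ B ∸ 1)) q ∧ testBit (2 ^ B) q
testBit-flag B e q = testBit-bitwise both refl (operands (e + (2 ^ B ∸ 1)) (2 ^ B)) q

testBit-2^-low : ∀ B {q} → q < B → testBit (2 ^ B) q ≡ false
testBit-2^-low B {q} q<B = trans (cong (λ a → testBit a q) (sym (*-identityˡ (2 ^ B)))) (testBit-shl-low 1 B q<B)

testBit-2^-high : ∀ B r → testBit (2 ^ B) (B + r) ≡ testBit 1 r
testBit-2^-high B r = trans (cong (λ a → testBit a (B + r)) (sym (*-identityˡ (2 ^ B)))) (testBit-shl-high 1 B r)

testBit-2^ : ∀ B → testBit (2 ^ B) B ≡ true
testBit-2^ B = trans (cong (testBit (2 ^ B)) (sym (+-identityʳ B))) (testBit-2^-high B 0)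

-- Writing the block as e + 1, the sum is e + 2 ^ B with e < 2 ^ B: the carry stops in bit B, and
-- the mask removes e.
flag-≢0 : ∀ B {e} → e ≢ 0 → e < 2 ^ B → flag B e ≡ 2 ^ B
flag-≢0 B {zero}  e≢0 _ = contradiction refl e≢0
flag-≢0 B {suc e} _ e<2^B = testBit-injective bit
  where
  carry : suc e + (2 ^ B ∸ 1) ≡ e + 2 ^ B * 1
  carry = trans (sym (+-suc e _)) (cong (e +_) (trans (2^≡suc B) (sym (*-identityʳ (2 ^ B)))))
  bit : ∀ q → testBit (flag B (suc e)) q ≡ testBit (2 ^ B) q
  bit q with q <? B
  ... | yes q<B = trans (testBit-flag B (suc e) q)
          (trans (cong (testBit (suc e + (2 ^ B ∸ 1)) q ∧_) (testBit-2^-low B q<B))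
            (trans (Bool.∧-zeroʳ _) (sym (testBit-2^-low B q<B))))
  ... | no  q≮B with r , refl ← m≤n⇒∃[o]m+o≡n (≮⇒≥ q≮B) = trans (testBit-flag B (suc e) (B + r))
          (trans (cong (_∧ testBit (2 ^ B) (B + r))
            (trans (cong (λ a → testBit a (B + r)) carry)
              (trans (testBit-++-high B 1 r (<⇒≤ e<2^B)) (sym (testBit-2^-high B r)))))
            (Bool.∧-idem (testBit (2 ^ B) (B + r))))

testBit-flag-0 : ∀ B → testBit (flag B 0) B ≡ false
testBit-flag-0 B = trans (testBit-flag B 0 B) (cong (_∧ testBit (2 ^ B) B) (testBit-≥ B (2^n∸1<2^n B) ≤-refl))

flag-< : ∀ B {e} → e < 2 ^ B → flag B e < 2 ^ suc B
flag-< B {e} e<2^B = bitwise-< both refl (suc B) (operands (e + (2 ^ B ∸ 1)) (2 ^ B)) λ where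
  zero    → +-mono-<-≤ e<2^B (≤-trans (m∸n≤m (2 ^ B) 1) (m≤m+n (2 ^ B) 0))
  (suc _) → 2^-mono-< (n<1+n B)

-- Testing all candidates in constant time

module _ {K : ℕ} (rule : Rule K) where
  open Rule rule using (accept; tableau)
  open Check rule using (Index; check; check-0; decode)

  -- Width 1 + inp + x has room for the input and grows with x; with 2 ^ x rows the area is the
  -- width shifted by x.
  accepts : ℕ → ℕ → Bool
  accepts inp x = accept (tableau (inp + x) (testBit inp) (2 ^ x ∸ 1) (inp + x))

  private
    module At inp x = Check.Lane rule (inp + x) (2 ^ x ∸ 1) inp
      (<-trans (n<2^n inp) (2^-mono-< (s≤s (m≤m+n inp x))))
    open At using (c; L; M; B; offset; mask; word; errors; errors-<; word-<)

    W N : ℕ → ℕ → ℕ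
    -- One bit more than an error word, for the carry that `flag` extracts.
    W inp x = suc (B inp x)
    N inp x = 2 ^ M inp x

    lanes : (ℕ → ℕ → ℕ → ℕ) → ℕ → ℕ → ℕ
    lanes a inp x = concat (W inp x) (N inp x) (a inp x)

    cᴱ : Expr c
    cᴱ = 1ᴱ +ᴱ (inpᴱ +ᴱ auxᴱ)

    Lᴱ : Expr L
    Lᴱ = castᴱ (λ inp x → trans (*-comm (c inp x) (2 ^ x)) (cong (_* c inp x) (sym (2^≡suc x)))) (cᴱ *2^ auxᴱ)

    Mᴱ : Expr M
    Mᴱ = suc K *ᴱ Lᴱ

    Bᴱ : Expr B
    Bᴱ = 1ᴱ +ᴱ (Mᴱ +ᴱ Mᴱ)

    Wᴱ : Expr W
    Wᴱ = 1ᴱ +ᴱ Bᴱ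

    maskᴱ : ∀ m → Expr (λ inp x → mask inp x m)
    maskᴱ valid = 2^ Lᴱ ∸1ᴱ
    maskᴱ final = 2^ᴱ Lᴱ
    maskᴱ left  = castᴱ (λ inp x → cong (λ n → concat (c inp x) n (λ _ → 1)) (sym (2^≡suc x)))
                    (repeatᴱ cᴱ auxᴱ 1ᴱ (λ _ _ → z<s))
    maskᴱ top   = 2^ cᴱ ∸1ᴱ
    maskᴱ input = inpᴱ

    offsetᴱ : ∀ d → Expr (λ inp x → offset inp x d)
    offsetᴱ here  = 0ᴱ
    offsetᴱ prev  = 1ᴱ
    offsetᴱ above = cᴱ

    constᴱ : ∀ {b} → Expr b → Expr (lanes (λ inp x _ → b inp x))
    constᴱ e = repeatᴱ Wᴱ Mᴱ e (λ _ _ → z<s)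

    wordᴱ : ∀ t → Expr (lanes (λ inp x → word inp x t))
    wordᴱ (inj₁ m) = castᴱ (λ inp x → concat-* (W inp x) (N inp x) (λ _ → mask inp x m) (2 ^ M inp x))
      (constᴱ (maskᴱ m) *2^ Mᴱ)
    wordᴱ (inj₂ (d , k)) = castᴱ
      (λ inp x → concat-* (W inp x) (N inp x) (λ i → i) (2 ^ ((K ∸ toℕ k) * L inp x + offset inp x d)))
      (iotaᴱ Wᴱ Mᴱ (λ _ _ → z<s) *2^ ((K ∸ toℕ k) *ᴱ Lᴱ +ᴱ offsetᴱ d))

    errorsᴱ : Expr (lanes errors)
    errorsᴱ = castᴱ
      (λ inp x → bitwise-concat check check-0 (W inp x) (N inp x) (λ j → word inp x (decode j))
        λ j i i<N → <-trans (word-< inp x (decode j) i i<N) (2^-mono-< (n<1+n (B inp x))))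
      (boolᴱ check (λ j → wordᴱ (decode j)))

    sumsᴱ : Expr (lanes (λ inp x i → errors inp x i + (2 ^ B inp x ∸ 1)))
    sumsᴱ = castᴱ (λ inp x → concat-+ (W inp x) (N inp x) (errors inp x) (λ _ → 2 ^ B inp x ∸ 1))
      (errorsᴱ +ᴱ constᴱ (2^ Bᴱ ∸1ᴱ))

    flags tops : ℕ → ℕ → ℕ → ℕ
    flags inp x i = flag (B inp x) (errors inp x i)
    tops  inp x _ = 2 ^ B inp x

    flagsᴱ : Expr (lanes flags)
    flagsᴱ = castᴱ
      (λ inp x → bitwise-concat both refl (W inp x) (N inp x)
        (λ j i → operands (errors inp x i + (2 ^ B inp x ∸ 1)) (2 ^ B inp x) j)
        λ where
          zero    i i<N → +-mono-<-≤ (errors-< inp x i i<N) (≤-trans (m∸n≤m (2 ^ B inp x) 1) (m≤m+n (2 ^ B inp x) 0))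
          (suc _) i i<N → 2^-mono-< (n<1+n (B inp x)))
      (boolᴱ both (pairᴱ sumsᴱ (constᴱ (2^ᴱ Bᴱ))))

    -- An accepting tableau yields a candidate without errors, whose missing flag makes the two
    -- numbers differ in its bit `B`. If the tableau does not accept, every candidate has an error
    -- and all flags are set.
    accepts-correct : ∀ inp x → accepts inp x ≡ not (lanes flags inp x ≡ᵇ lanes tops inp x)
    accepts-correct inp x with accepts inp x in eq
    ... | true  = cong not (sym (≢⇒≡ᵇ-false differ))
      where
      open At inp x using (witness; witness-<; witness-follows; follows⇒errors≡0)
      w b : ℕ
      w = witness
      b = B inp x
      flag-bit : testBit (lanes flags inp x) (w * W inp x + b) ≡ false
      flag-bit = trans
        (testBit-concat (W inp x) (N inp x) (λ i i<N → flag-< b (errors-< inp x i i<N)) witness-< (n<1+n b))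
        (trans (cong (λ e → testBit (flag b e) b) (follows⇒errors≡0 w witness-follows eq)) (testBit-flag-0 b))
      top-bit : testBit (lanes tops inp x) (w * W inp x + b) ≡ testBit (2 ^ b) b
      top-bit = testBit-concat (W inp x) (N inp x) (λ i i<N → 2^-mono-< (n<1+n b)) witness-< (n<1+n b)
      differ : lanes flags inp x ≢ lanes tops inp x
      differ same with () ← trans (sym (testBit-2^ b)) (trans (sym top-bit) (trans (cong (λ a → testBit a (w * W inp x + b)) (sym same)) flag-bit))
    ... | false = cong not (sym (trans (cong (_≡ᵇ lanes tops inp x) same) (≡ᵇ-refl (lanes tops inp x))))
      where
      same : lanes flags inp x ≡ lanes tops inp x
      same = concat-cong (W inp x) (N inp x) λ i i<N → flag-≢0 (B inp x)
        (λ e≡0 → contradiction (trans (sym (At.errors≡0⇒accept inp x i e≡0)) eq) λ ())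
        (errors-< inp x i i<N)

  accepts-computable : ∃[ t ] ComputableInTime [+,/,←,Bool] (λ _ → t) accepts
  accepts-computable = ≢-computable flagsᴱ (constᴱ (2^ᴱ Bᴱ)) accepts accepts-correct

open Plus using (add)

-- Simulation of RAM[+]

fromBits-∷ʳ : ∀ n f → fromBits (suc n) f ≡ fromBits n f + 2 ^ n * fromBool (f n)
fromBits-∷ʳ zero    f = trans (+-identityʳ _) (sym (+-identityʳ _))
fromBits-∷ʳ (suc n) f = trans (cong (λ a → fromBool (f 0) + 2 * a) (fromBits-∷ʳ n (f ∘ suc)))
  (lemma (fromBool (f 0)) (fromBits n (f ∘ suc)) (2 ^ n) (fromBool (f (suc n))))
  where
  lemma : ∀ b a p t → b + 2 * (a + p * t) ≡ b + 2 * a + 2 * p * t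
  lemma = solve-∀

xor₃ majority : Bool → Bool → Bool → Bool
xor₃ a b c = a xor (b xor c)
majority a b c = if a then b ∨ c else b ∧ c

full-adder : ∀ a b c → fromBool (xor₃ a b c) + 2 * fromBool (majority a b c) ≡
                       fromBool a + fromBool b + fromBool c
full-adder true  true  true  = refl
full-adder true  true  false = refl
full-adder true  false true  = refl
full-adder true  false false = refl
full-adder false true  true  = refl
full-adder false true  false = refl
full-adder false false true  = refl
full-adder false false false = refl

-- Induction on the prefix, appending bits at the top: the carry after n bits has weight 2 ^ n,
-- which is its weight as an input of the next full adder.
ripple-carry : ∀ (f g carry : ℕ → Bool) → carry 0 ≡ false →
               (∀ j → carry (suc j) ≡ majority (f j) (g j) (carry j)) → ∀ n →
               fromBits n (λ j → xor₃ (f j) (g j) (carry j)) + 2 ^ n * fromBool (carry n) ≡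
               fromBits n f + fromBits n g
ripple-carry f g carry carry-0 carry-suc zero rewrite carry-0 = refl
ripple-carry f g carry carry-0 carry-suc (suc n) = begin
  fromBits (suc n) s + 2 * 2 ^ n * fromBool (carry (suc n))
    ≡⟨ cong₂ (λ a b → a + 2 * 2 ^ n * fromBool b) (fromBits-∷ʳ n s) (carry-suc n) ⟩
  fromBits n s + 2 ^ n * fromBool (s n) + 2 * 2 ^ n * fromBool (majority (f n) (g n) (carry n))
    ≡⟨ lemma (fromBits n s) (2 ^ n) (fromBool (s n)) (fromBool (majority (f n) (g n) (carry n))) ⟩
  fromBits n s + 2 ^ n * (fromBool (s n) + 2 * fromBool (majority (f n) (g n) (carry n)))
    ≡⟨ cong (λ a → fromBits n s + 2 ^ n * a) (full-adder (f n) (g n) (carry n)) ⟩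
  fromBits n s + 2 ^ n * (fromBool (f n) + fromBool (g n) + fromBool (carry n))
    ≡⟨ lemma′ (fromBits n s) (2 ^ n) (fromBool (f n)) (fromBool (g n)) (fromBool (carry n)) ⟩
  fromBits n s + 2 ^ n * fromBool (carry n) + (2 ^ n * fromBool (f n) + 2 ^ n * fromBool (g n))
    ≡⟨ cong (_+ (2 ^ n * fromBool (f n) + 2 ^ n * fromBool (g n))) (ripple-carry f g carry carry-0 carry-suc n) ⟩
  fromBits n f + fromBits n g + (2 ^ n * fromBool (f n) + 2 ^ n * fromBool (g n))
    ≡⟨ lemma″ (fromBits n f) (fromBits n g) (2 ^ n * fromBool (f n)) (2 ^ n * fromBool (g n)) ⟩
  (fromBits n f + 2 ^ n * fromBool (f n)) + (fromBits n g + 2 ^ n * fromBool (g n))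
    ≡⟨ cong₂ _+_ (fromBits-∷ʳ n f) (fromBits-∷ʳ n g) ⟨
  fromBits (suc n) f + fromBits (suc n) g ∎
  where
  open ≡-Reasoning
  s : ℕ → Bool
  s j = xor₃ (f j) (g j) (carry j)
  lemma : ∀ a p s m → a + p * s + 2 * p * m ≡ a + p * (s + 2 * m)
  lemma = solve-∀
  lemma′ : ∀ a p f g c → a + p * (f + g + c) ≡ a + p * c + (p * f + p * g)
  lemma′ = solve-∀
  lemma″ : ∀ a b c d → a + b + (c + d) ≡ a + c + (b + d)
  lemma″ = solve-∀

module _ (f g differ : ℕ → Bool) (differ-0 : differ 0 ≡ false)
         (differ-suc : ∀ j → differ (suc j) ≡ differ j ∨ (f j xor g j)) where

  private
    xor-≡ : ∀ a b → a xor b ≡ false → a ≡ b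
    xor-≡ true  true  _ = refl
    xor-≡ false false _ = refl

    ∨-false : ∀ a b → a ∨ b ≡ false → a ≡ false × b ≡ false
    ∨-false false false _ = refl , refl

  differ-false : ∀ n → differ n ≡ false → ∀ j → j < n → f j ≡ g j
  differ-false (suc n) eq j j<1+n with ∨-false (differ n) _ (trans (sym (differ-suc n)) eq) | m<1+n⇒m<n∨m≡n j<1+n
  ... | p , _ | inj₁ j<n  = differ-false n p j j<n
  ... | _ , q | inj₂ refl = xor-≡ (f n) (g n) q

  -- Equal numbers have equal bits, and then the flag, false at the start, is never raised.
  differ-true : ∀ n → differ n ≡ true → fromBits n f ≢ fromBits n g
  differ-true n eq same = contradiction (trans (sym eq) (agree n ≤-refl)) λ ()
    where
    f≗g : ∀ j → j < n → f j ≡ g j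
    f≗g j j<n = trans (sym (testBit-fromBits n f j<n))
      (trans (cong (λ a → testBit a j) same) (testBit-fromBits n g j<n))
    agree : ∀ m → m ≤ n → differ m ≡ false
    agree zero    _   = differ-0
    agree (suc m) m<n rewrite differ-suc m | agree m (<⇒≤ m<n) | f≗g m m<n with g m
    ... | true  = refl
    ... | false = refl

-- Labels and registers as bits of a cell

unary : ∀ n → ℕ → Vec Bool n
unary zero    _       = []
unary (suc n) zero    = false ∷ unary n zero
unary (suc n) (suc l) = true ∷ unary n l

number : ∀ {n} → Vec Bool n → ℕ
number []          = 0
number (false ∷ _) = 0
number (true ∷ v)  = suc (number v)

-- Unary of fixed length truncates by itself, so labels need no bound before they are stored.
number-unary : ∀ n l → number (unary n l) ≡ l ⊓ n
number-unary zero    l       = sym (⊓-zeroʳ l)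
number-unary (suc n) zero    = refl
number-unary (suc n) (suc l) = cong suc (number-unary n l)

at-tabulate : ∀ {n} (f : ℕ → Bool) {i} → i < n → at (Vec.tabulate {n = n} (f ∘ toℕ)) i ≡ f i
at-tabulate {suc n} f {zero}  _         = refl
at-tabulate {suc n} f {suc i} (s≤s i<n) = at-tabulate (f ∘ suc) i<n

at-≥ : ∀ {n} (v : Vec Bool n) {i} → n ≤ i → at v i ≡ false
at-≥ []      _         = refl
at-≥ (b ∷ v) (s≤s n≤i) = at-≥ v n≤i

-- The bits of all registers at one bit position.
Memory : Set
Memory = ℕ → Bool

_[_≔ᵇ_] : Memory → ℕ → Bool → Memory
(w [ i ≔ᵇ b ]) j = if j ≡ᵇ i then b else w j

-- The flag marks the lowest position, the only one where the constant 1 has a bit.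
operandBit : Operand → Bool → Memory → Bool
operandBit 𝟎       d w = false
operandBit 𝟏       d w = d
operandBit (reg k) d w = w k

-- Only assignment targets and the input register 0 can ever hold a nonzero value, so registers from
-- this bound on may be read as 0. The base value 1 accounts for register 0.
bound : Program [+] → ℕ
bound []                   = 1
bound (assign i _ _ ∷ P)   = suc i ⊔ bound P
bound (compare _ _ _ _ ∷ P) = bound P
bound (jump _ ∷ P)         = bound P
bound (halt ∷ P)           = bound P

bound>0 : ∀ P → 0 < bound P
bound>0 []                   = z<s
bound>0 (assign i _ _ ∷ P)   = m≤n⇒m≤o⊔n (suc i) (bound>0 P)
bound>0 (compare _ _ _ _ ∷ P) = bound>0 P
bound>0 (jump _ ∷ P)         = bound>0 P
bound>0 (halt ∷ P)           = bound>0 P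

bound-∷ : ∀ c P → bound P ≤ bound (c ∷ P)
bound-∷ (assign i _ _)    P = m≤n⊔m (suc i) (bound P)
bound-∷ (compare _ _ _ _) P = ≤-refl
bound-∷ (jump _)          P = ≤-refl
bound-∷ halt              P = ≤-refl

target<bound : ∀ P l {i o as} → fetch P l ≡ just (assign i o as) → i < bound P
target<bound (assign i _ _ ∷ P) 1             refl = m≤m⊔n (suc i) (bound P)
target<bound (c ∷ P)            (suc (suc l)) eq   = <-≤-trans (target<bound P (suc l) eq) (bound-∷ c P)

fetch-0 : ∀ (P : Program [+]) → fetch P 0 ≡ nothing
fetch-0 []      = refl
fetch-0 (_ ∷ _) = refl

fetch-≤ : ∀ (P : Program [+]) l {c} → fetch P l ≡ just c → l ≤ length P
fetch-≤ (_ ∷ P) 1             _  = s≤s z≤n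
fetch-≤ (_ ∷ P) (suc (suc l)) eq = s≤s (fetch-≤ P (suc l) eq)

fetch-> : ∀ (P : Program [+]) l → length P < l → fetch P l ≡ nothing
fetch-> P l len<l with fetch P l in eq
... | nothing = refl
... | just _  = contradiction (fetch-≤ P l eq) (<⇒≱ len<l)

module Simulation (P : Program [+]) where

  n r K : ℕ
  n = suc (length P)
  r = bound P
  -- A carry, an inequality flag, the label in unary, and one bit of each stored register.
  K = 2 + (n + r)

  Cell : Set
  Cell = Vec Bool K

  Cmd : Set
  Cmd = Maybe (Command [+])

  -- Neither n nor any label above it carries a command, so truncation does not affect what is
  -- fetched.
  fetch-⊓ : ∀ l → fetch P (l ⊓ n) ≡ fetch P l
  fetch-⊓ l with ≤-total l n
  ... | inj₁ l≤n = cong (fetch P) (m≤n⇒m⊓n≡m l≤n)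
  ... | inj₂ n≤l = trans (cong (fetch P) (m≥n⇒m⊓n≡n n≤l)) (trans (fetch-> P n ≤-refl) (sym (fetch-> P l n≤l)))

  -- The labels beyond the program are identified with suc (length P).
  pack : Bool → Bool → Label → Memory → Cell
  pack carry neq l w = carry ∷ neq ∷ (unary n l Vec.++ Vec.tabulate (w ∘ toℕ))

  carryOf neqOf : Cell → Bool
  carryOf (carry ∷ _ ∷ _) = carry
  neqOf   (_ ∷ neq ∷ _)   = neq

  labelOf : Cell → Label
  labelOf (_ ∷ _ ∷ v) = number (Vec.take n v)

  memoryOf : Cell → Memory
  memoryOf (_ ∷ _ ∷ v) = at (Vec.drop n v)

  pack-++ : ∀ (u : Vec Bool n) (v : Vec Bool r) →
            Vec.take n (u Vec.++ v) ≡ u × Vec.drop n (u Vec.++ v) ≡ v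
  pack-++ u v = Vec.++-injective (Vec.take n (u Vec.++ v)) u (Vec.take++drop≡id n (u Vec.++ v))

  labelOf-pack : ∀ carry neq l w → labelOf (pack carry neq l w) ≡ l ⊓ n
  labelOf-pack carry neq l w =
    trans (cong number (proj₁ (pack-++ (unary n l) (Vec.tabulate (w ∘ toℕ))))) (number-unary n l)

  memoryOf-pack : ∀ carry neq l w → (∀ k → r ≤ k → w k ≡ false) → ∀ k → memoryOf (pack carry neq l w) k ≡ w k
  memoryOf-pack carry neq l w w-false k
    rewrite proj₂ (pack-++ (unary n l) (Vec.tabulate (w ∘ toℕ))) with k <? r
  ... | yes k<r = at-tabulate w k<r
  ... | no  k≮r = trans (at-≥ (Vec.tabulate {n = r} (w ∘ toℕ)) (≮⇒≥ k≮r)) (sym (w-false k (≮⇒≥ k≮r)))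

  carryStep neqStep : Cmd → Bool → Memory → Bool → Bool
  carryStep (just (assign _ add (a ∷ b ∷ []))) d w c = majority (operandBit a d w) (operandBit b d w) c
  carryStep _                                  d w c = c
  neqStep (just (compare a b _ _)) d w q = q ∨ (operandBit a d w xor operandBit b d w)
  neqStep _                        d w q = q

  memoryStep : Cmd → Bool → Memory → Bool → Memory
  memoryStep (just (assign i add (a ∷ b ∷ []))) d w c = w [ i ≔ᵇ xor₃ (operandBit a d w) (operandBit b d w) c ]
  memoryStep _                                  d w c = w

  -- d holds at the lowest bit of the row.
  exec : Bool → Bool → Bool → Label → Memory → Cell
  exec d c q l w = pack (carryStep (fetch P l) d w c) (neqStep (fetch P l) d w q) l (memoryStep (fetch P l) d w c)

  continue : Bool → Cell → Memory → Cell
  continue d u w = exec d (carryOf u) (neqOf u) (labelOf u) w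

  nextLabel : Cmd → Bool → Label → Label
  nextLabel (just (assign _ _ _))     q l = suc l
  nextLabel (just (compare _ _ l₁ l₂)) q l = if q then l₂ else l₁
  nextLabel (just (jump l′))          q l = l′
  nextLabel (just halt)               q l = l
  nextLabel nothing                   q l = l

  -- On overflow the machine is stuck at label 0.
  commit : Cell → Label
  commit u = if carryOf u then 0 else nextLabel (fetch P (labelOf u)) (neqOf u) (labelOf u)

  inputMemory : Bool → Memory
  inputMemory ι k = if k ≡ᵇ 0 then ι else false

  isHalt : Cmd → Bool
  isHalt (just halt) = true
  isHalt _           = false

  rule : Rule K
  rule = record
    { first  = λ ι → exec true false false 1 (inputMemory ι)
    ; load   = λ ι u → continue false u (inputMemory ι)
    ; step   = λ where
        true  u v → exec true false false (commit u) (memoryOf v)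
        false u v → continue false u (memoryOf v)
    ; accept = λ u → isHalt (fetch P (labelOf u))
    }

  -- The simulated machine as a total step function

  Config : Set
  Config = Label × Registers

  nextRegisters : Cmd → Registers → Registers
  nextRegisters (just (assign i add (a ∷ b ∷ []))) R = R [ i ≔ value R a + value R b ]
  nextRegisters _                                  R = R

  unequal : Cmd → Registers → Bool
  unequal (just (compare a b _ _)) R = not (value R a ≡ᵇ value R b)
  unequal _                        R = false

  -- At a halt or a missing command the configuration stays put, so the run can fill any number of
  -- rows.
  next : Config → Config
  next (l , R) = nextLabel (fetch P l) (unequal (fetch P l) R) l , nextRegisters (fetch P l) R

  run : ℕ → Config → Config
  run zero    s = s
  run (suc τ) s = next (run τ s)

  run-next : ∀ τ s → run τ (next s) ≡ next (run τ s)
  run-next zero    s = refl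
  run-next (suc τ) s = cong next (run-next τ s)

  Halted : Config → Set
  Halted (l , R) = fetch P l ≡ just halt

  run-sound : ∀ τ l R → Halted (run τ (l , R)) → ∃[ t ] ∃[ v ] P ⊢ l , R ⇓[ t ] v
  run-sound zero    l R halted = 1 , R 0 , halt halted
  run-sound (suc τ) l R halted
    with fetch P l in eq | run-sound τ (proj₁ (next (l , R))) (proj₂ (next (l , R)))
                             (subst Halted (sym (run-next τ (l , R))) halted)
  ... | just halt | _ = 1 , R 0 , halt eq
  ... | just (jump l′) | t , v , rest = suc t , v , jump eq rest
  ... | just (assign i add (a ∷ b ∷ [])) | t , v , rest = suc t , v , assign eq refl rest
  -- The configuration is its own successor here, so the derivation found for the successor serves
  -- unchanged.
  ... | nothing | t , v , rest = t , v , rest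
  ... | just (compare a b l₁ l₂) | t , v , rest with value R a ≟ value R b
  ...   | yes a≡b = suc t , v , compare-≡ eq a≡b (subst (λ e → P ⊢ (if not e then l₂ else l₁) , R ⇓[ t ] v)
                      (trans (cong (_≡ᵇ value R b) a≡b) (≡ᵇ-refl (value R b))) rest)
  ...   | no  a≢b = suc t , v , compare-≢ eq a≢b (subst (λ e → P ⊢ (if not e then l₂ else l₁) , R ⇓[ t ] v)
                      (≢⇒≡ᵇ-false a≢b) rest)

  run-complete : ∀ {l R t v} → P ⊢ l , R ⇓[ t ] v → ∃[ τ ] Halted (run τ (l , R))
  run-complete (halt eq) = 0 , eq
  run-complete {l} {R} (jump {l′ = l′} eq rest) with τ , halted ← run-complete rest =
    suc τ , subst Halted (trans (cong (run τ) step) (run-next τ (l , R))) halted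
    where
    step : (l′ , R) ≡ next (l , R)
    step rewrite eq = refl
  run-complete {l} {R} (compare-≡ {b = b} {l₁} eq a≡b rest) with τ , halted ← run-complete rest =
    suc τ , subst Halted (trans (cong (run τ) step) (run-next τ (l , R))) halted
    where
    step : (l₁ , R) ≡ next (l , R)
    step rewrite eq | a≡b | ≡ᵇ-refl (value R b) = refl
  run-complete {l} {R} (compare-≢ {l₂ = l₂} eq a≢b rest) with τ , halted ← run-complete rest =
    suc τ , subst Halted (trans (cong (run τ) step) (run-next τ (l , R))) halted
    where
    step : (l₂ , R) ≡ next (l , R)
    step rewrite eq | ≢⇒≡ᵇ-false a≢b = refl
  run-complete {l} {R} (assign {i = i} {add} {w} {a ∷ b ∷ []} eq refl rest) with τ , halted ← run-complete rest =
    suc τ , subst Halted (trans (cong (run τ) step) (run-next τ (l , R))) halted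
    where
    step : (suc l , R [ i ≔ w ]) ≡ next (l , R)
    step rewrite eq = refl

  next-halted : ∀ s → Halted s → next s ≡ s
  next-halted (l , R) eq rewrite eq = refl

  run-halted : ∀ {τ} s → Halted (run τ s) → ∀ d → run (d + τ) s ≡ run τ s
  run-halted s halted zero    = refl
  run-halted {τ} s halted (suc d) = trans (cong next (run-halted s halted d)) (next-halted (run τ s) halted)

  -- A step adds at most two values, so the bound at most doubles; 1 ≤ b covers the constant operand
  -- 1.
  run-bounded : ∀ {b l R} → 1 ≤ b → (∀ k → R k ≤ b) → ∀ τ k → proj₂ (run τ (l , R)) k ≤ 2 ^ τ * b
  run-bounded {b} {l} {R} 1≤b R≤b zero k = ≤-trans (R≤b k) (m≤m+n b 0)
  run-bounded {b} {l} {R} 1≤b R≤b (suc τ) = bounded (fetch P (proj₁ (run τ (l , R))))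
    where
    R′ : Registers
    R′ = proj₂ (run τ (l , R))
    B : ℕ
    B = 2 ^ τ * b
    R′≤B : ∀ k → R′ k ≤ B
    R′≤B = run-bounded 1≤b R≤b τ
    value≤B : ∀ a → value R′ a ≤ B
    value≤B 𝟎       = z≤n
    value≤B 𝟏       = *-mono-≤ (2^n>0 τ) 1≤b
    value≤B (reg k) = R′≤B k
    B+B : B + B ≡ 2 ^ suc τ * b
    B+B = lemma (2 ^ τ) b
      where
      lemma : ∀ p b → p * b + p * b ≡ 2 * p * b
      lemma = solve-∀
    bounded : ∀ m k → nextRegisters m R′ k ≤ 2 ^ suc τ * b
    unchanged : ∀ k → R′ k ≤ 2 ^ suc τ * b
    unchanged k = ≤-trans (R′≤B k) (≤-trans (m≤m+n B B) (≤-reflexive B+B))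
    bounded (just (assign i add (a ∷ c ∷ []))) k with k ≡ᵇ i
    ... | true  = ≤-trans (+-mono-≤ (value≤B a) (value≤B c)) (≤-reflexive B+B)
    ... | false = unchanged k
    bounded (just (compare _ _ _ _)) k = unchanged k
    bounded (just (jump _))          k = unchanged k
    bounded (just halt)              k = unchanged k
    bounded nothing                  k = unchanged k

  unary-⊓ : ∀ n l → unary n (l ⊓ n) ≡ unary n l
  unary-⊓ zero    l       = refl
  unary-⊓ (suc n) zero    = refl
  unary-⊓ (suc n) (suc l) = cong (true ∷_) (unary-⊓ n l)

  memoryOf-≥ : ∀ u {k} → r ≤ k → memoryOf u k ≡ false
  memoryOf-≥ (_ ∷ _ ∷ v) = at-≥ (Vec.drop n v)

  memoryStep-≥ : ∀ l d w c → (∀ k → r ≤ k → w k ≡ false) → ∀ k → r ≤ k → memoryStep (fetch P l) d w c k ≡ false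
  memoryStep-≥ l d w c w-false k r≤k with fetch P l in eq
  ... | just (assign i add (a ∷ b ∷ []))
        rewrite ≢⇒≡ᵇ-false (>⇒≢ (<-≤-trans (target<bound P l eq) r≤k)) = w-false k r≤k
  ... | just (compare _ _ _ _) = w-false k r≤k
  ... | just (jump _)          = w-false k r≤k
  ... | just halt              = w-false k r≤k
  ... | nothing                = w-false k r≤k

  -- The state on entering bit position j; the outcome of a whole row is found at j = c.
  scanCarry scanNeq : Cmd → (ℕ → Memory) → ℕ → Bool
  scanCarry m w zero    = false
  scanCarry m w (suc j) = carryStep m (j ≡ᵇ 0) (w j) (scanCarry m w j)
  scanNeq m w zero    = false
  scanNeq m w (suc j) = neqStep m (j ≡ᵇ 0) (w j) (scanNeq m w j)

  idle-carry : ∀ m → (∀ d w c → carryStep m d w c ≡ c) → ∀ {w} j → scanCarry m w j ≡ false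
  idle-carry m idle     zero    = refl
  idle-carry m idle {w} (suc j) = trans (idle _ (w j) _) (idle-carry m idle j)

  idle-neq : ∀ m → (∀ d w q → neqStep m d w q ≡ q) → ∀ {w} j → scanNeq m w j ≡ false
  idle-neq m idle     zero    = refl
  idle-neq m idle {w} (suc j) = trans (idle _ (w j) _) (idle-neq m idle j)

  module Scan (c′ : ℕ) (w : ℕ → Memory) (R : Registers)
              (w-R : ∀ k → fromBits (suc c′) (λ j → w j k) ≡ R k) where

    c : ℕ
    c = suc c′

    operandBits : Operand → ℕ → Bool
    operandBits a j = operandBit a (j ≡ᵇ 0) (w j)

    operand-value : ∀ a → fromBits c (operandBits a) ≡ value R a
    operand-value 𝟎       = fromBits-false c
      where
      fromBits-false : ∀ n → fromBits n (λ _ → false) ≡ 0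
      fromBits-false zero    = refl
      fromBits-false (suc n) = cong (2 *_) (fromBits-false n)
    operand-value 𝟏       =
      trans (fromBits-cong c (λ j _ → sym (bit j))) (fromBits-testBit c {1} (2^-mono-< {0} {c} z<s))
      where
      bit : ∀ j → testBit 1 j ≡ (j ≡ᵇ 0)
      bit zero    = refl
      bit (suc j) = testBit-zero j
    operand-value (reg k) = w-R k

    scan-add : ∀ i a b → let m = just (assign i add (a ∷ b ∷ [])) in
      fromBits c (λ j → xor₃ (operandBits a j) (operandBits b j) (scanCarry m w j)) +
        2 ^ c * fromBool (scanCarry m w c) ≡ value R a + value R b
    scan-add i a b =
      trans (ripple-carry (operandBits a) (operandBits b) (scanCarry (just (assign i add (a ∷ b ∷ []))) w) refl (λ _ → refl) c)
        (cong₂ _+_ (operand-value a) (operand-value b))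

    -- With no carry out of the last position the serial adder has produced the sum itself and not
    -- merely its residue modulo 2 ^ c.
    scan-memory : ∀ m → scanCarry m w c ≡ false → ∀ k →
                  fromBits c (λ j → memoryStep m (j ≡ᵇ 0) (w j) (scanCarry m w j) k) ≡ nextRegisters m R k
    scan-memory m@(just (assign i add (a ∷ b ∷ []))) no-carry k with k ≡ᵇ i
    ... | true  = begin
      s                                            ≡⟨ +-identityʳ s ⟨
      s + 0                                        ≡⟨ cong (s +_) (*-zeroʳ (2 ^ c)) ⟨
      s + 2 ^ c * fromBool false                   ≡⟨ cong (λ b → s + 2 ^ c * fromBool b) no-carry ⟨
      s + 2 ^ c * fromBool (scanCarry m w c)       ≡⟨ scan-add i a b ⟩
      value R a + value R b                        ∎
      where
      open ≡-Reasoning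
      s : ℕ
      s = fromBits c (λ j → xor₃ (operandBits a j) (operandBits b j) (scanCarry m w j))
    ... | false = w-R k
    scan-memory (just (compare _ _ _ _)) _ k = w-R k
    scan-memory (just (jump _))          _ k = w-R k
    scan-memory (just halt)              _ k = w-R k
    scan-memory nothing                  _ k = w-R k

    -- A final carry would contribute 2 ^ c to the sum, yet the sum is the new content of the target
    -- register, assumed smaller.
    scan-no-carry : ∀ m → (∀ k → nextRegisters m R k < 2 ^ c) → scanCarry m w c ≡ false
    scan-no-carry m@(just (assign i add (a ∷ b ∷ []))) small with scanCarry m w c | scan-add i a b
    ... | false | _  = refl
    ... | true  | eq = contradiction
            (≤-trans (≤-reflexive (sym (*-identityʳ (2 ^ c)))) (subst (2 ^ c * 1 ≤_) eq (m≤n+m (2 ^ c * 1) _)))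
            (<⇒≱ (subst (_< 2 ^ c) (≔-same R i (value R a + value R b)) (small i)))
    scan-no-carry m@(just (compare a b l₁ l₂)) _ = idle-carry m (λ _ _ _ → refl) {w} c
    scan-no-carry m@(just (jump l))            _ = idle-carry m (λ _ _ _ → refl) {w} c
    scan-no-carry m@(just halt)                _ = idle-carry m (λ _ _ _ → refl) {w} c
    scan-no-carry m@nothing                    _ = idle-carry m (λ _ _ _ → refl) {w} c

    scan-neq : ∀ m → scanNeq m w c ≡ unequal m R
    scan-neq m@(just (compare a b l₁ l₂)) with scanNeq m w c in eq
    ... | true  = cong not (sym (≢⇒≡ᵇ-false λ a≡b →
            differ-true (operandBits a) (operandBits b) (scanNeq m w) refl (λ _ → refl) c eq
              (trans (operand-value a) (trans a≡b (sym (operand-value b))))))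
    ... | false = cong not (sym (trans (cong (_≡ᵇ value R b) a≡b) (≡ᵇ-refl (value R b))))
      where
      a≡b : value R a ≡ value R b
      a≡b = trans (sym (operand-value a)) (trans
        (fromBits-cong c (differ-false (operandBits a) (operandBits b) (scanNeq m w) refl (λ _ → refl) c eq))
        (operand-value b))
    scan-neq m@(just (assign i o as)) = idle-neq m (λ _ _ _ → refl) {w} c
    scan-neq m@(just (jump l))        = idle-neq m (λ _ _ _ → refl) {w} c
    scan-neq m@(just halt)            = idle-neq m (λ _ _ _ → refl) {w} c
    scan-neq m@nothing                = idle-neq m (λ _ _ _ → refl) {w} c

  -- Rows of the tableau against configurations of the machine

  module Rows (c′ inp : ℕ) where

    c : ℕ
    c = suc c′

    cell : ℕ → ℕ → Cell
    cell = Rule.tableau rule c′ (testBit inp)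

    -- A row stores the registers after its own command; the registers before it are in the row
    -- above or, for row 0, in the input.
    source : ℕ → ℕ → Memory
    source zero    j = inputMemory (testBit inp j)
    source (suc τ) j = memoryOf (cell τ j)

    start : ℕ → Label
    start zero    = 1
    start (suc τ) = commit (cell τ c′)

    command : ℕ → Cmd
    command τ = fetch P (start τ)

    carry neq : ℕ → ℕ → Bool
    carry τ = scanCarry (command τ) (source τ)
    neq   τ = scanNeq (command τ) (source τ)

    number-at : ℕ → ℕ → ℕ
    number-at τ k = fromBits c (λ j → source τ j k)

    written : ℕ → ℕ → Memory
    written τ j = memoryStep (command τ) (j ≡ᵇ 0) (source τ j) (carry τ j)

    -- A cell holds the scan state after its own position, hence `suc j`. The label is repeated
    -- along the row, since each cell sees only the one before it.
    cell-shape : ∀ τ j → cell τ j ≡ pack (carry τ (suc j)) (neq τ (suc j)) (start τ) (written τ j)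
    cell-shape zero    zero    = refl
    cell-shape (suc τ) zero    = refl
    cell-shape τ       (suc j) = trans (cell-suc τ) (trans
      (cong (λ u → continue false u (source τ (suc j))) (cell-shape τ j)) continue-pack)
      where
      cell-suc : ∀ τ → cell τ (suc j) ≡ continue false (cell τ j) (source τ (suc j))
      cell-suc zero    = refl
      cell-suc (suc τ) = refl
      w : Memory
      w = source τ (suc j)
      continue-pack : exec false (carry τ (suc j)) (neq τ (suc j))
        (labelOf (pack (carry τ (suc j)) (neq τ (suc j)) (start τ) (written τ j))) w ≡
        pack (carry τ (suc (suc j))) (neq τ (suc (suc j))) (start τ) (written τ (suc j))
      continue-pack
        rewrite labelOf-pack (carry τ (suc j)) (neq τ (suc j)) (start τ) (written τ j) | fetch-⊓ (start τ)
              | unary-⊓ n (start τ) = refl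

    labelOf-cell : ∀ τ j → labelOf (cell τ j) ≡ start τ ⊓ n
    labelOf-cell τ j = trans (cong labelOf (cell-shape τ j)) (labelOf-pack (carry τ (suc j)) (neq τ (suc j)) (start τ) (written τ j))

    source-≥ : ∀ τ j k → r ≤ k → source τ j k ≡ false
    source-≥ zero    j zero    r≤0 = contradiction (bound>0 P) (≤⇒≯ r≤0)
    source-≥ zero    j (suc k) _   = refl
    source-≥ (suc τ) j k       r≤k = memoryOf-≥ (cell τ j) r≤k

    source-suc : ∀ τ j k → source (suc τ) j k ≡ written τ j k
    source-suc τ j k = trans (cong (λ u → memoryOf u k) (cell-shape τ j))
      (memoryOf-pack (carry τ (suc j)) (neq τ (suc j)) (start τ) (written τ j)
        (memoryStep-≥ (start τ) (j ≡ᵇ 0) (source τ j) (carry τ j) (source-≥ τ j)) k)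

    start-suc : ∀ τ → start (suc τ) ≡
                (if carry τ c then 0 else nextLabel (command τ) (neq τ c) (start τ ⊓ n))
    start-suc τ rewrite labelOf-cell τ c′ | fetch-⊓ (start τ) | cell-shape τ c′ = refl

    -- Labels are compared up to truncation, as the cells retain no more of them.
    Simulates : ℕ → Config → Set
    Simulates τ (l , R) = start τ ⊓ n ≡ l ⊓ n × (∀ k → number-at τ k ≡ R k)

    simulates-command : ∀ τ l R → Simulates τ (l , R) → command τ ≡ fetch P l
    simulates-command τ l R (label , _) = trans (sym (fetch-⊓ (start τ))) (trans (cong (fetch P) label) (fetch-⊓ l))

    simulates-initial : inp < 2 ^ c → Simulates 0 (1 , initial {[+]} (inp ∷ []))
    simulates-initial inp<2^c = refl , λ where
      zero    → fromBits-testBit c inp<2^c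
      (suc k) → trans (fromBits-cong c {g = testBit 0} (λ j _ → sym (testBit-zero j))) (fromBits-testBit c (2^n>0 c))

    nextLabel-⊓ : ∀ q l → nextLabel (fetch P l) q (l ⊓ n) ⊓ n ≡ nextLabel (fetch P l) q l ⊓ n
    nextLabel-⊓ q l with fetch P l in eq
    -- A label that carries a command lies below n, so truncation has not changed it before the
    -- increment.
    ... | just (assign _ _ _)      = cong (λ l → suc l ⊓ n) (m≤n⇒m⊓n≡m (m≤n⇒m≤1+n (fetch-≤ P l eq)))
    ... | just (compare _ _ _ _)   = refl
    ... | just (jump _)            = refl
    ... | just halt                = m≤n⇒m⊓n≡m (m⊓n≤n l n)
    ... | nothing                  = m≤n⇒m⊓n≡m (m⊓n≤n l n)

    simulates-next : ∀ τ s → Simulates τ s → carry τ c ≡ false → Simulates (suc τ) (next s)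
    simulates-next τ (l , R) sim@(label , memory) no-carry = label′ , memory′
      where
      open Scan c′ (source τ) R memory using (scan-memory; scan-neq)
      label′ : start (suc τ) ⊓ n ≡ nextLabel (fetch P l) (unequal (fetch P l) R) l ⊓ n
      label′ = begin
        start (suc τ) ⊓ n                                        ≡⟨ cong (_⊓ n) (start-suc τ) ⟩
        (if carry τ c then 0 else nextLabel (command τ) (neq τ c) (start τ ⊓ n)) ⊓ n
          ≡⟨ cong (λ b → (if b then 0 else nextLabel (command τ) (neq τ c) (start τ ⊓ n)) ⊓ n) no-carry ⟩
        nextLabel (command τ) (neq τ c) (start τ ⊓ n) ⊓ n        ≡⟨ cong₂ (λ q l → nextLabel (command τ) q l ⊓ n) (scan-neq (command τ)) label ⟩
        nextLabel (command τ) (unequal (command τ) R) (l ⊓ n) ⊓ n ≡⟨ cong (λ m → nextLabel m (unequal m R) (l ⊓ n) ⊓ n) (simulates-command τ l R sim) ⟩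
        nextLabel (fetch P l) (unequal (fetch P l) R) (l ⊓ n) ⊓ n ≡⟨ nextLabel-⊓ (unequal (fetch P l) R) l ⟩
        nextLabel (fetch P l) (unequal (fetch P l) R) l ⊓ n      ∎
        where open ≡-Reasoning
      memory′ : ∀ k → number-at (suc τ) k ≡ nextRegisters (fetch P l) R k
      memory′ k = trans (fromBits-cong c (λ j _ → source-suc τ j k))
        (trans (scan-memory (command τ) no-carry k) (cong (λ m → nextRegisters m R k) (simulates-command τ l R sim)))

    no-carry : ∀ τ s → Simulates τ s → (∀ k → proj₂ (next s) k < 2 ^ c) → carry τ c ≡ false
    no-carry τ (l , R) sim@(_ , memory) small = Scan.scan-no-carry c′ (source τ) R memory (command τ)
      λ k → subst (λ m → nextRegisters m R k < 2 ^ c) (sym (simulates-command τ l R sim)) (small k)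

    stuck : ∀ τ → start τ ≡ 0 → start (suc τ) ≡ 0
    stuck τ eq = trans (start-suc τ) still
      where
      still : (if carry τ c then 0 else nextLabel (command τ) (neq τ c) (start τ ⊓ n)) ≡ 0
      still with carry τ c
      ... | true  = refl
      ... | false rewrite eq | fetch-0 P = refl

    configuration : ℕ → Config
    configuration τ = run τ (1 , initial {[+]} (inp ∷ []))

    -- For every width that holds the input: either an overflow has occurred and label 0 is never
    -- left again, or the row agrees with the run.
    sound : inp < 2 ^ c → ∀ τ → start τ ≡ 0 ⊎ Simulates τ (configuration τ)
    sound inp<2^c zero    = inj₂ (simulates-initial inp<2^c)
    sound inp<2^c (suc τ) with sound inp<2^c τ | carry τ c in eq
    ... | inj₁ start≡0 | _     = inj₁ (stuck τ start≡0)
    ... | inj₂ sim     | true  = inj₁ (trans (start-suc τ) (cong (if_then 0 else nextLabel (command τ) (neq τ c) (start τ ⊓ n)) eq))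
    ... | inj₂ sim     | false = inj₂ (simulates-next τ (configuration τ) sim eq)

    complete : (∀ τ k → proj₂ (configuration τ) k < 2 ^ c) → ∀ τ → Simulates τ (configuration τ)
    complete small zero    = simulates-initial (small 0 0)
    complete small (suc τ) = simulates-next τ (configuration τ) (complete small τ)
      (no-carry τ (configuration τ) (complete small τ) (small (suc τ)))

    accept-cell : ∀ τ j → Rule.accept rule (cell τ j) ≡ isHalt (command τ)
    accept-cell τ j = cong isHalt (trans (cong (fetch P) (labelOf-cell τ j)) (fetch-⊓ (start τ)))

    accept-sound : inp < 2 ^ c → ∀ τ j → Rule.accept rule (cell τ j) ≡ true → HaltsOn P (inp ∷ [])
    accept-sound inp<2^c τ j acc with trans (sym (accept-cell τ j)) acc | sound inp<2^c τ
    ... | halts | inj₁ start≡0 with () ← trans (sym (cong isHalt (trans (cong (fetch P) start≡0) (fetch-0 P)))) halts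
    ... | halts | inj₂ sim = run-sound τ _ _ (halted (trans (sym (cong isHalt (simulates-command τ _ _ sim))) halts))
      where
      halted : ∀ {m} → isHalt m ≡ true → m ≡ just halt
      halted {just halt} _ = refl

    accept-complete : (∀ τ k → proj₂ (configuration τ) k < 2 ^ c) → ∀ τ j → Halted (configuration τ) →
                      Rule.accept rule (cell τ j) ≡ true
    accept-complete small τ j halted = trans (accept-cell τ j)
      (cong isHalt (trans (simulates-command τ _ _ (complete small τ)) halted))

-- Acceptance and halting

accepts-halting : ∀ (P : Program [+]) inp x → accepts (Simulation.rule P) inp x ≡ true → HaltsOn P (inp ∷ [])
accepts-halting P inp x = accept-sound (<-trans (n<2^n inp) (2^-mono-< (s≤s (m≤m+n inp x)))) (2 ^ x ∸ 1) (inp + x)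
  where open Simulation.Rows P (inp + x) inp

halting-accepted : ∀ (P : Program [+]) inp → HaltsOn P (inp ∷ []) →
                   ∃[ x₀ ] (∀ x → x₀ ≤ x → accepts (Simulation.rule P) inp x ≡ true)
halting-accepted P inp (_ , _ , halting) with τ₀ , halted ← Simulation.run-complete P halting = τ₀ , accepted
  where
  open Simulation P
  s₀ : Config
  s₀ = 1 , initial {[+]} (inp ∷ [])

  run-late : ∀ {τ} → τ₀ ≤ τ → run τ s₀ ≡ run τ₀ s₀
  run-late τ₀≤τ with d , refl ← m≤n⇒∃[o]m+o≡n τ₀≤τ =
    trans (cong (λ τ → run τ s₀) (+-comm τ₀ d)) (run-halted s₀ halted d)

  initial≤ : ∀ k → initial {[+]} (inp ∷ []) k ≤ suc inp
  initial≤ zero    = n≤1+n inp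
  initial≤ (suc k) = z≤n

  -- One bound serves for all τ, because growth ends with the halt at τ₀.
  register≤ : ∀ τ k → proj₂ (run τ s₀) k ≤ 2 ^ τ₀ * suc inp
  register≤ τ k with ≤-total τ τ₀
  ... | inj₁ τ≤τ₀ = ≤-trans (run-bounded (s≤s z≤n) initial≤ τ k) (*-monoˡ-≤ (suc inp) (2^-mono-≤ τ≤τ₀))
  ... | inj₂ τ₀≤τ = ≤-trans (≤-reflexive (cong (λ s → proj₂ s k) (run-late τ₀≤τ)))
                            (run-bounded (s≤s z≤n) initial≤ τ₀ k)

  accepted : ∀ x → τ₀ ≤ x → accepts rule inp x ≡ true
  accepted x τ₀≤x = Rows.accept-complete (inp + x) inp small (2 ^ x ∸ 1) (inp + x)
    -- From x < 2 ^ x follows τ₀ ≤ x ≤ 2 ^ x - 1, so the last row lies at or after the halt.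
    (subst Halted (sym (run-late (≤-trans τ₀≤x (≤-pred (≤-trans (n<2^n x) (≤-reflexive (sym (2^≡suc x)))))))) halted)
    where
    open ≤-Reasoning
    small : ∀ τ k → proj₂ (run τ s₀) k < 2 ^ suc (inp + x)
    small τ k = begin-strict
      proj₂ (run τ s₀) k   ≤⟨ register≤ τ k ⟩
      2 ^ τ₀ * suc inp     ≤⟨ *-mono-≤ (2^-mono-≤ τ₀≤x) (n<2^n inp) ⟩
      2 ^ x * 2 ^ inp      ≡⟨ ^-distribˡ-+-* 2 x inp ⟨
      2 ^ (x + inp)        <⟨ 2^-mono-< (s≤s (≤-reflexive (+-comm x inp))) ⟩
      2 ^ suc (inp + x)    ∎

theorem5 : ∀ {ℓ} (S : Pred ℕ ℓ) → RecursivelyEnumerable S →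
    Σ[ f ∈ (ℕ → ℕ) ] ((f ∈O[ (λ _ → 1) ]) × (ARAM [+,/,←,Bool] Recognizes S InTime f))
theorem5 S (P , S⇔halts) =
  (λ _ → t) , (t , 0 , λ _ _ → ≤-reflexive (sym (*-identityʳ t))) ,
  accepts rule , computable , λ inp → accepted inp , rejected inp
  where
  open Simulation P using (rule)
  t : ℕ
  t = proj₁ (accepts-computable rule)
  computable : ComputableInTime [+,/,←,Bool] (λ _ → t) (accepts rule)
  computable = proj₂ (accepts-computable rule)

  accepted : ∀ inp → S inp → AllButFinitelyMany (λ x → fromBool (accepts rule inp x) ≢ 0)
  accepted inp inp∈S with x₀ , accepts-≥ ← halting-accepted P inp (Equivalence.to (S⇔halts inp) inp∈S) =
    -- Below x₀ the tableau may be too small to contain the halting run.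
    upTo x₀ , λ x x∉ → subst (λ b → fromBool b ≢ 0) (sym (accepts-≥ x (≮⇒≥ λ x<x₀ → x∉ (∈-upTo⁺ x<x₀)))) λ ()

  rejected : ∀ inp → ¬ S inp → AllButFinitelyMany (λ x → fromBool (accepts rule inp x) ≡ 0)
  -- No exceptions arise: acceptance implies halting for every x.
  rejected inp inp∉S = [] , λ x _ → cong fromBool
    (Bool.¬-not λ acc → inp∉S (Equivalence.from (S⇔halts inp) (accepts-halting P inp x acc)))
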